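{- In multihop Peg Duotaire, let $P\subseteq\{0,1\}^*$ be the set of words $w$ such that the position $w$ is a $\mathcal{P}$-position, and let $N=\{0,1\}^*\setminus P$ be the set of words whose position is an $\mathcal{N}$-position. Then neither $P$ nor $N$ is a regular language, and neither is a context-free language.
   Context: Peg Duotaire is an impartial two-player game played on the infinite line of sites indexed by $\mathbb{Z}$, each site holding a peg or being a hole, with finitely many pegs. A word $w\in\{0,1\}^*$ denotes the position in which $w$ is written on consecutive sites ($1$ = peg, $0$ = hole) and all other sites are holes. A hop: for a peg at site $i$, a peg at site $i+d$ and a hole at site $i+2d$ ($d=\pm1$), move the peg from $i$ to $i+2d$ and remove the peg at $i+d$. In the multihop version, a move is a sequence of one or more hops all performed by the same peg. Players alternate moves; a player unable to move loses. A $\mathcal{P}$-position is one from which the player who just moved (the second player) has a winning strategy, equivalently nim-value $0$; an $\mathcal{N}$-position is one from which the player to move wins, equivalently nonzero nim-value. -}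

module Defs where

open import Data.Bool.Base using (Bool; true; false; if_then_else_)
open import Data.Empty using (⊥-elim)
open import Data.Fin.Base using (Fin)
open import Data.Fin.Subset using (Subset) renaming (_∈_ to _∈ˢ_)
open import Data.Integer.Base using (ℤ; +_; -[1+_]; 1ℤ; -1ℤ; _+_; _*_)
open import Data.Integer.Properties using (_≟_; +-0-abelianGroup)
open import Data.List.Base using (List; []; _∷_; _++_; length; map; filter; foldl; upTo)
open import Data.List.Membership.Propositional using (_∈_)
open import Data.List.Membership.Propositional.Properties using (∈-filter⁺; ∈-map⁺; ∈-upTo⁺)
open import Data.List.Properties using (filter-notAll)
open import Data.List.Relation.Unary.All using (decide; lookup)
open import Data.List.Relation.Unary.Any using (here; there; satisfied) renaming (map to mapAny)
open import Data.Nat.Base using (ℕ; zero; suc; pred; _≤_; _<_; z≤n; s≤s)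
open import Data.Nat.Properties using (≤-trans; ≤-refl; m≤n⇒m≤1+n)
open import Data.Product.Base using (Σ-syntax; ∃-syntax; ∃₂; _×_; _,_)
open import Data.Sum.Base using (_⊎_; inj₁; inj₂)
open import Function.Base using (_∘_)
open import Level using (0ℓ)
open import Relation.Binary.Construct.Closure.ReflexiveTransitive using (Star)
open import Relation.Binary.Construct.Closure.Transitive using (TransClosure; [_]; _∷_)
open import Relation.Binary.Core using (Rel)
open import Relation.Binary.PropositionalEquality using (_≡_; _≢_; sym)
open import Relation.Nullary.Decidable using (yes; no; does; ¬?; _×-dec_)
open import Relation.Nullary.Negation using (¬_)
open import Relation.Unary using (Pred; ∁; _≐_)
import Data.Bool.Properties as Bool
open import Algebra.Properties.AbelianGroup +-0-abelianGroup using (identityʳ-unique)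

-- true = peg, false = hole.  Finiteness of the set of pegs is not part of
-- the type: it holds for every ⟦ w ⟧ and is preserved by hops (see
-- ⟦⟧-bounded and hop-bounded below).
Position : Set
Position = ℤ → Bool

Word : Set
Word = List Bool

at : Word → ℕ → Bool
at []      n       = false
at (b ∷ w) zero    = b
at (b ∷ w) (suc n) = at w n

-- The word occupies sites 0, …, length w - 1.
⟦_⟧ : Word → Position
⟦ w ⟧ (+ n)    = at w n
⟦ w ⟧ -[1+ n ] = false

data Direction : Set where
  left right : Direction

step : Direction → ℤ
step left  = -1ℤ
step right = 1ℤ

_[_≔_] : Position → ℤ → Bool → Position
(p [ i ≔ b ]) j = if does (j ≟ i) then b else p j

afterHop : Position → ℤ → Direction → Position
afterHop p i d = ((p [ i ≔ false ]) [ i + step d ≔ false ]) [ i + + 2 * step d ≔ true ]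

-- The second component is the current site of the hopping peg.
data _↷_ : Rel (Position × ℤ) 0ℓ where
  hop : ∀ {p i} (d : Direction) →
        p i ≡ true → p (i + step d) ≡ true → p (i + + 2 * step d) ≡ false →
        (p , i) ↷ (afterHop p i d , i + + 2 * step d)

Move : Rel Position 0ℓ
Move p q = ∃₂ λ i j → TransClosure _↷_ (p , i) (q , j)

-- Proofs are winning strategies, for the second and the first player
-- respectively, under the convention that a player unable to move loses.
mutual
  data IsP (p : Position) : Set where
    everyMoveToN : (∀ q → Move p q → IsN q) → IsP p

  data IsN (p : Position) : Set where
    someMoveToP : ∀ q → Move p q → IsP q → IsN p

Language : Set → Set₁
Language A = Pred (List A) 0ℓ

record DFA (A : Set) : Set where
  field
    states : ℕ
    start  : Fin states
    δ      : Fin states → A → Fin states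
    final  : Subset states

  recognised : Language A
  recognised w = foldl δ start w ∈ˢ final

Regular : ∀ {A} → Language A → Set
Regular {A} L = Σ[ M ∈ DFA A ] L ≐ DFA.recognised M

record CFG (A : Set) : Set where
  field
    nonterminals : ℕ

  Nonterminal : Set
  Nonterminal = Fin nonterminals

  SententialForm : Set
  SententialForm = List (Nonterminal ⊎ A)

  field
    start : Nonterminal
    rules : List (Nonterminal × SententialForm)

  data _⇒_ : Rel SententialForm 0ℓ where
    rewriteStep : ∀ u v {X α} → (X , α) ∈ rules →
                  (u ++ inj₁ X ∷ v) ⇒ (u ++ α ++ v)

  generated : Language A
  generated w = Star _⇒_ (inj₁ start ∷ []) (map inj₂ w)

ContextFree : ∀ {A} → Language A → Set
ContextFree {A} L = Σ[ G ∈ CFG A ] L ≐ CFG.generated G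

P-words : Language Bool
P-words w = IsP ⟦ w ⟧

-- By determinacy this is the set of words whose position is an
-- N-position: see N-words≐IsN below.
N-words : Language Bool
N-words = ∁ P-words

Bounded : ℕ → Position → Set
Bounded n p = Σ[ S ∈ List ℤ ] length S ≤ n × (∀ i → p i ≡ true → i ∈ S)

weaken : ∀ n {p} → Bounded (pred n) p → Bounded n p
weaken zero    b                = b
weaken (suc n) (S , len , pegs) = S , m≤n⇒m≤1+n len , pegs

private
  without : ℤ → List ℤ → List ℤ
  without i = filter (λ j → ¬? (j ≟ i))

  length-without : ∀ {i S} → i ∈ S → length (without i S) < length S
  length-without {i} {S} i∈S =
    filter-notAll (λ j → ¬? (j ≟ i)) S (mapAny (λ i≡j j≢i → j≢i (sym i≡j)) i∈S)

  step≢0 : ∀ i d → i + step d ≢ i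
  step≢0 i d eq with identityʳ-unique i (step d) eq
  step≢0 i left  eq | ()
  step≢0 i right eq | ()

  noPegs : ∀ {p i} → Bounded 0 p → ¬ (p i ≡ true)
  noPegs {i = i} ([] , z≤n , pegs) pi with pegs i pi
  ... | ()

hop-bounded : ∀ {n p i q j} → (p , i) ↷ (q , j) → Bounded (suc n) p → Bounded n q
hop-bounded {n} {p} {i} (hop d pi pd _) (S , len , pegs) = S′ , len′ , pegs′
  where
  k l : ℤ
  k = i + step d
  l = i + + 2 * step d

  S′ : List ℤ
  S′ = l ∷ without k (without i S)

  len′ : length S′ ≤ n
  len′ with ≤-trans (s≤s (length-without k∈)) (≤-trans (length-without (pegs i pi)) len)
    where
    k∈ : k ∈ without i S
    k∈ = ∈-filter⁺ (λ j → ¬? (j ≟ i)) (pegs k pd) (step≢0 i d)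
  ... | s≤s le = le

  pegs′ : ∀ j → afterHop p i d j ≡ true → j ∈ S′
  pegs′ j eq with j ≟ l
  ... | yes j≡l = here j≡l
  ... | no _ with j ≟ k
  pegs′ j () | no _ | yes _
  ... | no j≢k with j ≟ i
  pegs′ j () | no _ | no _ | yes _
  ... | no j≢i = there (∈-filter⁺ (λ m → ¬? (m ≟ k))
                         (∈-filter⁺ (λ m → ¬? (m ≟ i)) (pegs j eq) j≢i) j≢k)

⟦⟧-bounded : ∀ w → ∃[ n ] Bounded n ⟦ w ⟧
⟦⟧-bounded w = _ , map +_ (upTo (length w)) , ≤-refl , pegs
  where
  at< : ∀ v n → at v n ≡ true → n < length v
  at< (b ∷ v) zero    _  = s≤s z≤n
  at< (b ∷ v) (suc n) eq = s≤s (at< v n eq)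

  pegs : ∀ i → ⟦ w ⟧ i ≡ true → i ∈ map +_ (upTo (length w))
  pegs (+ n) eq = ∈-map⁺ +_ (∈-upTo⁺ (at< w n eq))

private
  module _ {A B : Position → Set} where

    Some All : Position × ℤ → Set
    Some s = ∃₂ λ q j → TransClosure _↷_ s (q , j) × A q
    All  s = ∀ q j → TransClosure _↷_ s (q , j) → B q

    decideFrom : ∀ n {p} i → Bounded n p →
                 (∀ q → Bounded (pred n) q → A q ⊎ B q) → Some (p , i) ⊎ All (p , i)
    decideFrom zero i b h = inj₂ λ where
      q j [ hop _ pi _ _ ]   → ⊥-elim (noPegs b pi)
      q j (hop _ pi _ _ ∷ _) → ⊥-elim (noPegs b pi)
    decideFrom (suc n) {p} i b h with try left | try right
      where
      Through : Direction → Set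
      Through d = ∀ q j → p i ≡ true → p (i + step d) ≡ true → p (i + + 2 * step d) ≡ false →
                  B (afterHop p i d) ×
                  (TransClosure _↷_ (afterHop p i d , i + + 2 * step d) (q , j) → B q)

      try : ∀ d → Some (p , i) ⊎ Through d
      try d with (p i Bool.≟ true) ×-dec (p (i + step d) Bool.≟ true)
                 ×-dec (p (i + + 2 * step d) Bool.≟ false)
      ... | no illegal = inj₂ λ q j x y z → ⊥-elim (illegal (x , y , z))
      ... | yes (x , y , z) with hop-bounded (hop d x y z) b
      ... | b′ with h _ b′ | decideFrom n (i + + 2 * step d) b′ (λ q → h q ∘ weaken n)
      ... | inj₁ a | _                     = inj₁ (_ , _ , [ hop d x y z ] , a)
      ... | inj₂ _ | inj₁ (q , j , t , a)  = inj₁ (q , j , hop d x y z ∷ t , a)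
      ... | inj₂ c | inj₂ all              = inj₂ λ q j _ _ _ → c , all q j
    ... | inj₁ s | _      = inj₁ s
    ... | inj₂ _ | inj₁ s = inj₁ s
    ... | inj₂ f | inj₂ g = inj₂ λ where
      q j [ hop left  x y z ]   → let (c , _) = f q j x y z in c
      q j [ hop right x y z ]   → let (c , _) = g q j x y z in c
      q j (hop left  x y z ∷ t) → let (_ , k) = f q j x y z in k t
      q j (hop right x y z ∷ t) → let (_ , k) = g q j x y z in k t

outcome : ∀ n p → Bounded n p → IsP p ⊎ IsN p
outcome zero p b = inj₁ (everyMoveToN λ where
  q (_ , _ , [ hop _ pi _ _ ])   → ⊥-elim (noPegs b pi)
  q (_ , _ , hop _ pi _ _ ∷ _) → ⊥-elim (noPegs b pi))
outcome (suc n) p b@(S , _ , pegs)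
  with decide (λ i → swap (decideFrom {IsP} {IsN} (suc n) i b (outcome n))) S
  where
  swap : ∀ {X Y : Set} → X ⊎ Y → Y ⊎ X
  swap (inj₁ x) = inj₂ x
  swap (inj₂ y) = inj₁ y
... | inj₂ some with satisfied some
...   | i , q , j , t , P-q = inj₂ (someMoveToP q (i , j , t) P-q)
outcome (suc n) p b@(S , _ , pegs) | inj₁ all = inj₁ (everyMoveToN λ where
  q (i , j , t@([ hop _ pi _ _ ]))   → lookup all (pegs i pi) q j t
  q (i , j , t@(hop _ pi _ _ ∷ _)) → lookup all (pegs i pi) q j t)

IsN⇒¬IsP : ∀ {p} → IsN p → ¬ IsP p
IsN⇒¬IsP (someMoveToP q m P-q) (everyMoveToN f) = IsN⇒¬IsP (f q m) P-q

N-words≐IsN : N-words ≐ (λ w → IsN ⟦ w ⟧)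
N-words≐IsN = to , IsN⇒¬IsP
  where
  to : ∀ {w} → N-words w → IsN ⟦ w ⟧
  to {w} ¬P with ⟦⟧-bounded w
  ... | n , b with outcome n ⟦ w ⟧ b
  ...   | inj₁ P-w = ⊥-elim (¬P P-w)
  ...   | inj₂ N-w = N-w

{-# OPTIONS --safe #-}

-- The word 0(01)ᵏ10 behaves as a nim heap of size k: its only adjacent pegs
-- are the last two, and the last peg can hop left any number of times, leaving
-- 0(01)ˡ10 with l < k, or the last but one can hop right, leaving no adjacent
-- pegs.  Concatenations of such words are therefore nim positions, and a
-- concatenation is a P-position iff the nim-sum of its heap sizes is zero.
--
-- The triples (x, 2x, 3x) have nim-sum zero iff x has no two adjacent binary
-- digits 1.  If words w₀, w₁, … of a context-free language all lead a finite
-- automaton to the same state, then for some i < j the transition counts of wᵢ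
-- and wⱼ differ by some d such that all counts of wᵢ plus t d occur in the
-- language as well: by Dickson's lemma the multiset of rules used for wᵢ is
-- contained in that for wⱼ and has the same support, and the surplus rules form
-- cycles which can be inserted into the derivation of wᵢ arbitrarily often.  On the triples (x, 2x, 3x) this is
-- refuted by x = 2ᵐ for P and by x = 3 · 2ᵐ for N.
module Submission where

open import Defs
open import Data.Bool.Base using (Bool; true; false; not; if_then_else_; _xor_)
open import Data.Empty using (⊥-elim)
open import Data.Fin.Base using (Fin; zero; suc; toℕ)
open import Data.Fin.Patterns using (0F; 1F; 2F; 3F)
import Data.Fin.Properties as Fin
open import Data.Fin.Subset using () renaming (_∈_ to _∈ˢ_)
open import Data.Integer.Base using (ℤ; 1ℤ; -1ℤ) renaming (+_ to infix 8 ⁺_; _+_ to _+ᶻ_)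
import Data.Integer.Properties as ℤ
open import Algebra.Properties.AbelianGroup ℤ.+-0-abelianGroup using (∙-cancelʳ)
open import Data.List.Base using (List; []; _∷_; _++_; length; map; concat; concatMap; replicate; foldl; lookup; allFin; cartesianProduct)
open import Data.List.Membership.Propositional using (_∈_; find; lose)
open import Data.List.Membership.Propositional.Properties using (∈-map⁺; ∈-map⁻; ∈-++⁺ʳ; ∈-++⁻; ∈-lookup; ∈-concatMap⁺; ∈-concatMap⁻; ∈-allFin; ∈-cartesianProduct⁺)
open import Data.List.Properties using (map-++; ++-assoc; ++-identityʳ; length-++; foldl-++)
open import Data.List.Relation.Binary.Permutation.Propositional using (_↭_; ↭-refl; ↭-sym; ↭-trans; ↭-reflexive; prep; swap)
open import Data.List.Relation.Binary.Permutation.Propositional.Properties using (map⁺; shift; ++⁺ˡ; ++⁺ʳ; ++-comm; ∈-resp-↭; ↭-length; ↭-empty-inv)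
open import Data.List.Relation.Unary.All using (All; []; _∷_) renaming (lookup to All-lookup)
open import Data.List.Relation.Unary.All.Properties using (++⁻ˡ; ++⁻ʳ)
open import Data.List.Relation.Unary.Any using (here; there; index)
open import Data.List.Relation.Unary.Any.Properties using (lookup-index)
open import Data.Maybe.Base using (Maybe; just; nothing)
import Data.Maybe.Properties as Maybe
open import Data.Nat.Base
open import Data.Nat.ListAction using (sum)
open import Data.Nat.ListAction.Properties using (sum-++; sum-↭)
open import Data.Nat.Properties
open import Data.Nat.Tactic.RingSolver using (solve-∀)
open import Data.Product.Base using (∃-syntax; ∃₂; _×_; _,_; proj₁; proj₂)
open import Data.Product.Properties using (≡-dec)
open import Data.Sum.Base using (_⊎_; inj₁; inj₂)
open import Data.Unit.Base using (⊤; tt)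
open import Data.Vec.Base using (Vec; []; _∷_; _[_]≔_)
import Data.Vec.Base as Vec
open import Data.Vec.Properties using ([]≔-lookup; []≔-idempotent; map-[]≔; lookup-map; lookup∘update; lookup∘update′)
open import Relation.Binary.Construct.Closure.ReflexiveTransitive using (Star; ε; _◅_; gmap)
open import Relation.Binary.Construct.Closure.Transitive using (TransClosure; [_]; _∷_)
open import Relation.Binary.Definitions using (DecidableEquality)
open import Relation.Binary.PropositionalEquality using (_≡_; _≢_; refl; sym; trans; cong; cong₂; subst; subst₂; ≢-sym; module ≡-Reasoning)
open import Relation.Nullary.Decidable using (yes; no; does)
open import Relation.Nullary.Negation using (¬_; contradiction)

-- Commutative grammars

total : {A : Set} → (A → ℕ) → List A → ℕ
total f xs = sum (map f xs)

total-++ : {A : Set} (f : A → ℕ) (xs ys : List A) → total f (xs ++ ys) ≡ total f xs + total f ys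
total-++ f xs ys = trans (cong sum (map-++ f xs ys)) (sum-++ (map f xs) (map f ys))

total-↭ : {A : Set} (f : A → ℕ) {xs ys : List A} → xs ↭ ys → total f xs ≡ total f ys
total-↭ f p = sum-↭ (map⁺ f p)

total-power : {A : Set} (f : A → ℕ) → ∀ t z → total f (concat (replicate t z)) ≡ t * total f z
total-power f zero z = refl
total-power f (suc t) z = trans (total-++ f z _) (cong (total f z +_) (total-power f t z))

total>0⇒extract : {A : Set} (f : A → ℕ) (xs : List A) → 0 < total f xs →
                  ∃₂ λ x ys → xs ↭ x ∷ ys × 0 < f x
total>0⇒extract f (x ∷ xs) pos with f x in eq
... | suc _ = x , xs , ↭-refl , subst (0 <_) (sym eq) z<s
... | zero with total>0⇒extract f xs pos
...   | y , ys , p , q = y , x ∷ ys , ↭-trans (prep x p) (swap x y ↭-refl) , q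

module Multiplicity {K : Set} (_≟_ : DecidableEquality K) where

  𝟙 : K → K → ℕ
  𝟙 k l = if does (k ≟ l) then 1 else 0

  # : K → List K → ℕ
  # k = total (𝟙 k)

  𝟙-refl : ∀ k → 𝟙 k k ≡ 1
  𝟙-refl k with k ≟ k
  ... | yes _ = refl
  ... | no k≢k = ⊥-elim (k≢k refl)

  𝟙>0⇒≡ : ∀ {k l} → 0 < 𝟙 k l → k ≡ l
  𝟙>0⇒≡ {k} {l} pos with k ≟ l
  ... | yes k≡l = k≡l

  #>0⇒extract : ∀ k xs → 0 < # k xs → ∃[ ys ] xs ↭ k ∷ ys
  #>0⇒extract k xs pos with total>0⇒extract (𝟙 k) xs pos
  ... | l , ys , p , q with 𝟙>0⇒≡ q
  ...   | refl = ys , p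

  #-head>0 : ∀ k xs → 0 < # k (k ∷ xs)
  #-head>0 k xs = ≤-trans (≤-reflexive (sym (𝟙-refl k))) (m≤m+n (𝟙 k k) (# k xs))

  ∈⇒#>0 : ∀ {k xs} → k ∈ xs → 0 < # k xs
  ∈⇒#>0 {k} {x ∷ xs} (here refl) = #-head>0 k xs
  ∈⇒#>0 {k} {x ∷ xs} (there i) = ≤-trans (∈⇒#>0 i) (m≤n+m _ (𝟙 k x))

  #≤⇒complement : ∀ xs ys → (∀ k → # k xs ≤ # k ys) → ∃[ zs ] ys ↭ xs ++ zs
  #≤⇒complement [] ys le = ys , ↭-refl
  #≤⇒complement (x ∷ xs) ys le
    with #>0⇒extract x ys (≤-trans (#-head>0 x xs) (le x))
  ... | ys′ , p
    with #≤⇒complement xs ys′ (λ k → +-cancelˡ-≤ (𝟙 k x) _ _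
           (≤-trans (le k) (≤-reflexive (total-↭ (𝟙 k) p))))
  ...   | zs , q = zs , ↭-trans p (prep x q)

module CommutativeGrammar {K R : Set} (_≟_ : DecidableEquality K)
                          (lhs : R → K) (rhs : R → List K) where

  open Multiplicity _≟_

  infix 4 _⇛[_]_
  -- Sentential forms are multisets, given as lists up to permutation. The index records the rules
  -- in order of firing, so every additive weight of a derivation can be read off it.
  data _⇛[_]_ : List K → List R → List K → Set where
    stop : ∀ {M N} → M ↭ N → M ⇛[ [] ] N
    fire : ∀ {M M′ N y} r → M ↭ lhs r ∷ M′ → rhs r ++ M′ ⇛[ y ] N → M ⇛[ r ∷ y ] N

  consumed produced : K → List R → ℕ
  consumed k = total (λ r → 𝟙 k (lhs r))
  produced k = total (λ r → # k (rhs r))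

  -- Kirchhoff's law: with the grammar read as a Petri net, these are its T-invariants, the rule
  -- multisets without net effect.
  Balanced : List R → Set
  Balanced y = ∀ k → produced k y ≡ consumed k y

  ↭-⇛ : ∀ {M M′ y N} → M ↭ M′ → M′ ⇛[ y ] N → M ⇛[ y ] N
  ↭-⇛ p (stop q) = stop (↭-trans p q)
  ↭-⇛ p (fire r q d) = fire r (↭-trans p q) d

  ⇛-trans : ∀ {M y N z O} → M ⇛[ y ] N → N ⇛[ z ] O → M ⇛[ y ++ z ] O
  ⇛-trans (stop p) e = ↭-⇛ p e
  ⇛-trans (fire r p d) e = fire r p (⇛-trans d e)

  ⇛-frame : ∀ {M y N} F → M ⇛[ y ] N → M ++ F ⇛[ y ] N ++ F
  ⇛-frame F (stop p) = stop (++⁺ʳ F p)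
  ⇛-frame F (fire {M′ = M′} r p d) =
    fire r (++⁺ʳ F p) (↭-⇛ (↭-reflexive (sym (++-assoc (rhs r) M′ F))) (⇛-frame F d))

  ⇛-balance : ∀ {M y N} → M ⇛[ y ] N → ∀ k → # k M + produced k y ≡ # k N + consumed k y
  ⇛-balance {M} {_} {N} (stop p) k = cong (_+ 0) (total-↭ (𝟙 k) p)
  ⇛-balance {M} {_} {N} (fire {M′ = M′} {y = y} r p d) k = begin
    # k M + (# k (rhs r) + produced k y)                ≡⟨ cong (_+ _) (total-↭ (𝟙 k) p) ⟩
    𝟙 k (lhs r) + # k M′ + (# k (rhs r) + produced k y) ≡⟨ lem (𝟙 k (lhs r)) (# k M′) (# k (rhs r)) (produced k y) ⟩
    # k (rhs r) + # k M′ + produced k y + 𝟙 k (lhs r)   ≡⟨ cong (λ n → n + produced k y + 𝟙 k (lhs r)) (total-++ (𝟙 k) (rhs r) M′) ⟨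
    # k (rhs r ++ M′) + produced k y + 𝟙 k (lhs r)      ≡⟨ cong (_+ 𝟙 k (lhs r)) (⇛-balance d k) ⟩
    # k N + consumed k y + 𝟙 k (lhs r)                  ≡⟨ lem′ (# k N) (consumed k y) (𝟙 k (lhs r)) ⟩
    # k N + (𝟙 k (lhs r) + consumed k y)                ∎
    where
    open ≡-Reasoning
    lem : ∀ a b c d → a + b + (c + d) ≡ c + b + d + a
    lem = solve-∀
    lem′ : ∀ a b c → a + b + c ≡ a + (c + b)
    lem′ = solve-∀

  -- The balance provides every symbol of M with an expansion in y, so the
  -- rewriting can only stop at M = [].
  exhaust : ∀ n y M → length y ≤ n → (∀ k → # k M + produced k y ≡ consumed k y) →
            ∃₂ λ u v → y ↭ u ++ v × M ⇛[ u ] [] × Balanced v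
  exhaust n y [] _ bal = [] , y , ↭-refl , stop ↭-refl , bal
  exhaust n y (k ∷ M) len bal
    with total>0⇒extract (λ r → 𝟙 k (lhs r)) y
           (≤-trans (#-head>0 k M) (≤-trans (m≤m+n _ (produced k y)) (≤-reflexive (bal k))))
  ... | r , y′ , p , q with 𝟙>0⇒≡ q
  exhaust zero y (k ∷ M) len bal | r , y′ , p , q | refl
    with ≤-trans (≤-reflexive (sym (↭-length p))) len
  ... | ()
  exhaust (suc n) y (k ∷ M) len bal | r , y′ , p , q | refl
    with exhaust n y′ (rhs r ++ M) (≤-pred (≤-trans (≤-reflexive (sym (↭-length p))) len)) bal′
    where
    lem : ∀ a b c d → a + (c + b + d) ≡ a + b + (c + d)
    lem = solve-∀
    open ≡-Reasoning
    bal′ : ∀ l → # l (rhs r ++ M) + produced l y′ ≡ consumed l y′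
    bal′ l = +-cancelˡ-≡ (𝟙 l k) _ _ (begin
      𝟙 l k + (# l (rhs r ++ M) + produced l y′)      ≡⟨ cong (λ n → 𝟙 l k + (n + produced l y′)) (total-++ (𝟙 l) (rhs r) M) ⟩
      𝟙 l k + (# l (rhs r) + # l M + produced l y′)   ≡⟨ lem (𝟙 l k) (# l M) (# l (rhs r)) (produced l y′) ⟩
      𝟙 l k + # l M + (# l (rhs r) + produced l y′)   ≡⟨ cong (𝟙 l k + # l M +_) (total-↭ (λ r → # l (rhs r)) p) ⟨
      𝟙 l k + # l M + produced l y                    ≡⟨ bal l ⟩
      consumed l y                                    ≡⟨ total-↭ (λ r → 𝟙 l (lhs r)) p ⟩
      𝟙 l k + consumed l y′                           ∎)
  ... | u , v , p′ , d , bal″ = r ∷ u , v , ↭-trans p (prep r p′) , fire r ↭-refl d , bal″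

  -- Keeping `first` apart from `others` makes the cycle visibly nonempty, so `rest` is shorter than
  -- `y`. Nothing forces `rest` to be connected to the cycle; it only inherits balance.
  record Pump (y : List R) : Set where
    constructor pump
    field
      {root}     : K
      {first}    : R
      {others}   : List R
      {rest}     : List R
      split      : y ↭ (first ∷ others) ++ rest
      derivation : root ∷ [] ⇛[ first ∷ others ] root ∷ []
      balanced   : Balanced rest

  -- The partial derivation k ⇛ M is extended upwards, by a rule of y producing
  -- k, until its root reappears among its leaves.
  climb : ∀ n y {k r x} M → length y ≤ n → k ∷ [] ⇛[ r ∷ x ] M →
          (∀ l → # l M + produced l y ≡ consumed l y + 𝟙 l k) → Pump ((r ∷ x) ++ y)
  climb n y {k} {r} {x} M len d bal with # k M in eq
  ... | suc m = close (#>0⇒extract k M (subst (0 <_) (sym eq) z<s))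
    where
    close : ∃[ M′ ] M ↭ k ∷ M′ → Pump ((r ∷ x) ++ y)
    -- With the reappeared root removed from the leaves, the invariant becomes the hypothesis of
    -- `exhaust`: rules of `y` erase the other leaves, while the root is carried along as a frame.
    close (M′ , p) with exhaust n y M′ len bal′
      where
      lem : ∀ a b c → a + b + c ≡ (b + c) + a
      lem = solve-∀
      bal′ : ∀ l → # l M′ + produced l y ≡ consumed l y
      bal′ l = +-cancelʳ-≡ (𝟙 l k) _ _ (trans (sym (lem (𝟙 l k) (# l M′) (produced l y)))
                 (trans (cong (_+ produced l y) (sym (total-↭ (𝟙 l) p))) (bal l)))
    ... | u , v , p′ , e , bal″ = pump
      (↭-trans (++⁺ˡ (r ∷ x) p′) (↭-reflexive (sym (++-assoc (r ∷ x) u v))))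
      (⇛-trans d (↭-⇛ (↭-trans p (++-comm (k ∷ []) M′)) (⇛-frame (k ∷ []) e)))
      bal″
  ... | zero
    with total>0⇒extract (λ s → # k (rhs s)) y
           (≤-trans (≤-reflexive (sym (𝟙-refl k))) (≤-trans (m≤n+m (𝟙 k k) (consumed k y))
             (≤-reflexive (trans (sym (bal k)) (cong (_+ produced k y) eq)))))
  ...   | s , y′ , p , pos with #>0⇒extract k (rhs s) pos
  climb zero y M len d bal | zero | s , y′ , p , pos | β , q
    with ≤-trans (≤-reflexive (sym (↭-length p))) len
  ... | ()
  climb (suc n) y {k} {r} {x} M len d bal | zero | s , y′ , p , pos | β , q
    with climb n y′ {lhs s} {s} {r ∷ x} (M ++ β) (≤-pred (≤-trans (≤-reflexive (sym (↭-length p))) len))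
           (fire s ↭-refl (↭-⇛ (↭-trans (↭-reflexive (++-identityʳ (rhs s))) q) (⇛-frame β d))) bal′
    where
    lem : ∀ a b c d → a + b + c + d ≡ a + ((d + b) + c)
    lem = solve-∀
    lem′ : ∀ a b c → a + b + c ≡ b + a + c
    lem′ = solve-∀
    open ≡-Reasoning
    bal′ : ∀ l → # l (M ++ β) + produced l y′ ≡ consumed l y′ + 𝟙 l (lhs s)
    bal′ l = +-cancelʳ-≡ (𝟙 l k) _ _ (begin
      # l (M ++ β) + produced l y′ + 𝟙 l k         ≡⟨ cong (λ n → n + produced l y′ + 𝟙 l k) (total-++ (𝟙 l) M β) ⟩
      # l M + # l β + produced l y′ + 𝟙 l k        ≡⟨ lem (# l M) (# l β) (produced l y′) (𝟙 l k) ⟩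
      # l M + (# l (k ∷ β) + produced l y′)        ≡⟨ cong (λ n → # l M + (n + produced l y′)) (total-↭ (𝟙 l) q) ⟨
      # l M + (# l (rhs s) + produced l y′)        ≡⟨ cong (# l M +_) (total-↭ (λ s → # l (rhs s)) p) ⟨
      # l M + produced l y                         ≡⟨ bal l ⟩
      consumed l y + 𝟙 l k                         ≡⟨ cong (_+ 𝟙 l k) (total-↭ (λ s → 𝟙 l (lhs s)) p) ⟩
      𝟙 l (lhs s) + consumed l y′ + 𝟙 l k          ≡⟨ lem′ (𝟙 l (lhs s)) (consumed l y′) (𝟙 l k) ⟩
      consumed l y′ + 𝟙 l (lhs s) + 𝟙 l k          ∎)
  ... | pump p′ e b = pump (↭-trans (↭-trans (++⁺ˡ (r ∷ x) p) (shift s (r ∷ x) y′)) p′) e b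

  findPump : ∀ {r y} → Balanced (r ∷ y) → Pump (r ∷ y)
  findPump {r} {y} bal =
    climb (length y) y (rhs r ++ []) ≤-refl (fire r ↭-refl (stop ↭-refl))
      (λ l → trans (cong (λ M → # l M + produced l y) (++-identityʳ (rhs r)))
                   (trans (bal l) (+-comm (𝟙 l (lhs r)) (consumed l y))))

  -- The cycle is spliced in immediately before a rule with left side `k` fires, when `k` is
  -- present; the other symbols are a frame.
  insertPump : ∀ {k u} → k ∷ [] ⇛[ u ] k ∷ [] → ∀ {M x} → M ⇛[ x ] [] → k ∈ map lhs x →
               ∃[ x′ ] x′ ↭ u ++ x × M ⇛[ x′ ] []
  insertPump {k} {u} e (fire {M′ = M′} {y = y} r p d) (here refl) =
    u ++ r ∷ y , ↭-refl , ↭-⇛ p (⇛-trans (⇛-frame M′ e) (fire r ↭-refl d))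
  insertPump {k} {u} e (fire {y = y} r p d) (there i) with insertPump e d i
  ... | x′ , q , d′ = r ∷ x′ , ↭-trans (prep r q) (↭-sym (shift r u y)) , fire r p d′

  -- A balanced list may fall into several cycles, which are peeled off by `findPump` one at a time.
  -- The root of each is the left side of a rule of `z`, hence by assumption also of one in `x`, so
  -- the derivation passes through it. The bound `n` makes the recursion terminate.
  insertBalanced : ∀ n z {M x} → length z ≤ n → Balanced z → (∀ {r} → r ∈ z → lhs r ∈ map lhs x) →
                   M ⇛[ x ] [] → ∃[ x′ ] x′ ↭ z ++ x × M ⇛[ x′ ] []
  insertBalanced n [] len bal sub d = _ , ↭-refl , d
  insertBalanced (suc n) (r ∷ z) {M} {x} (s≤s len) bal sub d with findPump bal
  ... | pump {others = o} {rest = v} p (fire s q e) bal′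
    -- A one-element multiset can only fire its own element, so the root is `lhs s`.
    with ∈-resp-↭ (↭-sym q) (here refl)
  ... | here refl
    with insertPump (fire s q e) d (sub (∈-resp-↭ (↭-sym p) (here refl)))
  ... | x₁ , p₁ , d₁
    with insertBalanced n v len′ bal′ sub′ d₁
    where
    len′ : length v ≤ n
    len′ = ≤-trans (≤-pred (≤-trans (s≤s (m≤n+m (length v) (length o)))
             (≤-trans (≤-reflexive (sym (cong suc (length-++ o {v})))) (≤-reflexive (sym (↭-length p))))))
             len
    sub′ : ∀ {t} → t ∈ v → lhs t ∈ map lhs x₁
    sub′ {t} i = ∈-resp-↭ (↭-sym (map⁺ lhs p₁))
               (subst (lhs t ∈_) (sym (map-++ lhs (s ∷ o) x))
                 (∈-++⁺ʳ (map lhs (s ∷ o)) (sub (∈-resp-↭ (↭-sym p) (∈-++⁺ʳ (s ∷ o) i)))))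
  ... | x₂ , p₂ , d₂ = x₂ , ↭-trans p₂ (↭-trans (++⁺ˡ v p₁) (↭-trans (↭-reflexive (sym (++-assoc v (s ∷ o) x)))
                         (++⁺ʳ x (↭-trans (++-comm v (s ∷ o)) (↭-sym p))))) , d₂

module Repetition {K R : Set} (_≟_ : DecidableEquality K) (_≟ᴿ_ : DecidableEquality R)
                  (lhs : R → K) (rhs : R → List K) where
  open Multiplicity _≟_
  open Multiplicity _≟ᴿ_ using () renaming
    (# to #ᴿ; #≤⇒complement to #ᴿ≤⇒complement; ∈⇒#>0 to ∈⇒#ᴿ>0; #>0⇒extract to #ᴿ>0⇒extract)
  open CommutativeGrammar _≟_ lhs rhs

  Balanced-++ : ∀ {y z} → Balanced y → Balanced z → Balanced (y ++ z)
  Balanced-++ {y} {z} b c k = trans (total-++ _ y z) (trans (cong₂ _+_ (b k) (c k)) (sym (total-++ _ y z)))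

  Balanced-power : ∀ {z} → Balanced z → ∀ t → Balanced (concat (replicate t z))
  Balanced-power b zero k = refl
  Balanced-power {z} b (suc t) = Balanced-++ {z} b (Balanced-power b t)

  -- Both derivations erase the same `M`, so their balance equations differ by that of `z` alone.
  difference-balanced : ∀ {M x y z} → M ⇛[ x ] [] → M ⇛[ y ] [] → y ↭ x ++ z → Balanced z
  difference-balanced {M} {x} {y} {z} d e p k = +-cancelˡ-≡ (consumed k x) _ _ (begin
    consumed k x + produced k z              ≡⟨ cong (_+ produced k z) (⇛-balance d k) ⟨
    # k M + produced k x + produced k z      ≡⟨ +-assoc (# k M) (produced k x) (produced k z) ⟩
    # k M + (produced k x + produced k z)    ≡⟨ cong (# k M +_) (total-++ _ x z) ⟨
    # k M + produced k (x ++ z)              ≡⟨ cong (# k M +_) (total-↭ _ p) ⟨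
    # k M + produced k y                     ≡⟨ ⇛-balance e k ⟩
    consumed k y                             ≡⟨ total-↭ _ p ⟩
    consumed k (x ++ z)                      ≡⟨ total-++ _ x z ⟩
    consumed k x + consumed k z              ∎)
    where open ≡-Reasoning

  ∈-power : ∀ {r : R} t z → r ∈ concat (replicate t z) → r ∈ z
  ∈-power (suc t) z i with ∈-++⁻ z i
  ... | inj₁ j = j
  ... | inj₂ j = ∈-power t z j

  -- The term `1 ∸ #ᴿ r x` indicates the absence of `r`. The second inequality thus says that a rule
  -- missing from `x` is missing from `y`; hence `z` uses only rules of `x`, which lets its copies
  -- be inserted.
  repeatDifference : ∀ {M x y} → M ⇛[ x ] [] → M ⇛[ y ] [] →
    (∀ r → #ᴿ r x ≤ #ᴿ r y) → (∀ r → 1 ∸ #ᴿ r x ≤ 1 ∸ #ᴿ r y) →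
    ∃[ z ] y ↭ x ++ z × (∀ t → ∃[ x′ ] x′ ↭ concat (replicate t z) ++ x × M ⇛[ x′ ] [])
  repeatDifference {M} {x} {y} d e le zero-le with #ᴿ≤⇒complement x y le
  ... | z , p = z , p , λ t →
    insertBalanced _ (concat (replicate t z)) ≤-refl (Balanced-power (difference-balanced d e p) t)
      (λ i → ∈-map⁺ lhs (z⊆x (∈-power t z i))) d
    where
    z⊆x : ∀ {r} → r ∈ z → r ∈ x
    z⊆x {r} i with #ᴿ r x in eq | zero-le r
    ... | suc _ | _ with #ᴿ>0⇒extract r x (subst (0 <_) (sym eq) z<s)
    ...   | _ , q = ∈-resp-↭ (↭-sym q) (here refl)
    z⊆x {r} i | zero | le′ with #ᴿ r y | ∈⇒#ᴿ>0 (∈-resp-↭ (↭-sym p) (∈-++⁺ʳ x i))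
    z⊆x {r} i | zero | () | suc zero | _
    z⊆x {r} i | zero | () | suc (suc _) | _

-- Dickson's lemma

-- Membership in the index sets is undecidable in general; the double negation is harmless because
-- the final goals are negations.
Infinite : (ℕ → Set) → Set
Infinite I = ∀ N → ¬ ¬ (∃[ m ] N ≤ m × I m)

SuffixMinimum : (ℕ → Set) → (ℕ → ℕ) → ℕ → Set
SuffixMinimum I f m = I m × (∀ k → m ≤ k → I k → f m ≤ f k)

-- Were there no suffix minimum from `N` on, each index of `I` beyond `N` would be followed by one
-- with a smaller value of `f`, an infinite descent.
suffixMinima-infinite : ∀ {I} f → Infinite I → Infinite (SuffixMinimum I f)
suffixMinima-infinite {I} f inf N none = inf N λ where (m , N≤m , Im) → descend (f m) m ≤-refl N≤m Im
  where
  descend : ∀ b m → f m ≤ b → N ≤ m → ¬ I m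
  descend b m fm≤b N≤m Im = none (m , N≤m , Im , minimal b fm≤b)
    where
    minimal : ∀ b → f m ≤ b → ∀ k → m ≤ k → I k → f m ≤ f k
    minimal b fm≤b k m≤k Ik with f m ≤? f k
    ... | yes le = le
    minimal zero fm≤b k m≤k Ik | no nle = ⊥-elim (nle (≤-trans fm≤b z≤n))
    minimal (suc b) fm≤b k m≤k Ik | no nle =
      ⊥-elim (descend b k (≤-pred (≤-trans (≰⇒> nle) fm≤b)) (≤-trans N≤m m≤k) Ik)

-- Restricted to its suffix minima, `f` is weakly increasing, so any pair found there for the
-- remaining functions also serves `f`.
dickson : ∀ {I} (fs : List (ℕ → ℕ)) → Infinite I →
          ¬ ¬ (∃₂ λ i j → i < j × I i × I j × All (λ f → f i ≤ f j) fs)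
dickson [] inf none = inf 0 λ where
  (i , _ , Ii) → inf (suc i) λ where (j , i<j , Ij) → none (i , j , i<j , Ii , Ij , [])
dickson (f ∷ fs) inf none = dickson fs (suffixMinima-infinite f inf) λ where
  (i , j , i<j , (Ii , min) , (Ij , _) , le) → none (i , j , i<j , Ii , Ij , min j (<⇒≤ i<j) Ij ∷ le)

-- Pumping along sequences of words

module Leftmost {A : Set} (G : CFG A) where
  open CFG G

  infix 4 _⊢_
  data _⊢_ : SententialForm → List A → Set where
    done     : [] ⊢ []
    terminal : ∀ {a α w} → α ⊢ w → inj₂ a ∷ α ⊢ a ∷ w
    expand   : ∀ {X β α w} → (X , β) ∈ rules → β ++ α ⊢ w → inj₁ X ∷ α ⊢ w

  ⊢-++ : ∀ {α β v w} → α ⊢ v → β ⊢ w → α ++ β ⊢ v ++ w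
  ⊢-++ done e = e
  ⊢-++ (terminal d) e = terminal (⊢-++ d e)
  ⊢-++ {β = β} (expand {β = γ} {α = α} r d) e = expand r (subst (_⊢ _) (++-assoc γ α β) (⊢-++ d e))

  map-inj₂-⊢ : ∀ w → map inj₂ w ⊢ w
  map-inj₂-⊢ [] = done
  map-inj₂-⊢ (a ∷ w) = terminal (map-inj₂-⊢ w)

  -- A rewriting step at any place can be postponed until its nonterminal is leftmost. This turns
  -- arbitrary derivations into leftmost ones, working backwards from the last step.
  ⊢-unstep : ∀ u {v X β φ w} → (X , β) ∈ rules → φ ⊢ w → φ ≡ u ++ β ++ v → u ++ inj₁ X ∷ v ⊢ w
  ⊢-unstep [] r d refl = expand r d
  ⊢-unstep (inj₂ a ∷ u) r (terminal d) refl = terminal (⊢-unstep u r d refl)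
  ⊢-unstep (inj₁ Y ∷ u) {v} {X} {β} r (expand {β = γ} r′ d) refl =
    expand r′ (subst (_⊢ _) (++-assoc γ u (inj₁ X ∷ v))
      (⊢-unstep (γ ++ u) r d (sym (++-assoc γ u (β ++ v)))))

  ⇒*⇒⊢ : ∀ {α β w} → Star _⇒_ α β → β ≡ map inj₂ w → α ⊢ w
  ⇒*⇒⊢ {w = w} ε refl = map-inj₂-⊢ w
  ⇒*⇒⊢ (rewriteStep u v r ◅ s) eq = ⊢-unstep u r (⇒*⇒⊢ s eq) refl

  ⊢⇒⇒* : ∀ {α w} → α ⊢ w → Star _⇒_ α (map inj₂ w)
  ⊢⇒⇒* done = ε
  ⊢⇒⇒* (terminal {a} d) = gmap (inj₂ a ∷_) (λ where (rewriteStep u v r) → rewriteStep (inj₂ a ∷ u) v r) (⊢⇒⇒* d)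
  ⊢⇒⇒* (expand {α = α} r d) = rewriteStep [] α r ◅ ⊢⇒⇒* d

-- Product of a grammar with a weighted automaton

module Weighted {A Q I : Set} (δ : Q → A → Q) (μ : Q → A → I → ℕ) where

  weight : Q → List A → I → ℕ
  weight q [] ι = 0
  weight q (a ∷ w) ι = μ q a ι + weight (δ q a) w ι

  weight-++ : ∀ q v w ι → weight q (v ++ w) ι ≡ weight q v ι + weight (foldl δ q v) w ι
  weight-++ q [] w ι = refl
  weight-++ q (a ∷ v) w ι = trans (cong (μ q a ι +_) (weight-++ (δ q a) v w ι)) (sym (+-assoc (μ q a ι) _ _))

module Annotation {A Q I : Set} (G : CFG A) (_≟_ : DecidableEquality Q)
                  (states : List Q) (all-states : ∀ q → q ∈ states)
                  (δ : Q → A → Q) (μ : Q → A → I → ℕ) where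
  open CFG G
  open Leftmost G
  open Weighted δ μ

  -- (q , X , q′) stands for X deriving a word that leads from q to q′.
  Symbol : Set
  Symbol = Q × Nonterminal × Q

  record Annotated : Set where
    constructor annotated
    field
      target  : Q
      charge  : I → ℕ
      symbols : List Symbol
  open Annotated

  charged : (I → ℕ) → Annotated → Annotated
  charged c (annotated q d M) = annotated q (λ ι → c ι + d ι) M

  prefixed : Symbol → Annotated → Annotated
  prefixed k (annotated q d M) = annotated q d (k ∷ M)

  -- The triple construction for intersecting a grammar with an automaton: the state after each
  -- nonterminal is guessed in all ways. Terminals are run and charged at once, so only nonterminals
  -- remain as symbols and complete derivations end in `[]`.
  annotations : Q → SententialForm → List Annotated
  annotations q [] = annotated q (λ _ → 0) [] ∷ []
  annotations q (inj₂ a ∷ α) = map (charged (μ q a)) (annotations (δ q a) α)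
  annotations q (inj₁ X ∷ α) = concatMap (λ q′ → map (prefixed (q , X , q′)) (annotations q′ α)) states

  ∈-expand⁺ : ∀ α {q X q′ e} → e ∈ annotations q′ α → prefixed (q , X , q′) e ∈ annotations q (inj₁ X ∷ α)
  ∈-expand⁺ α {q} {X} {q′} i =
    ∈-concatMap⁺ (λ q′ → map (prefixed (q , X , q′)) (annotations q′ α)) {xs = states}
      (lose (all-states q′) (∈-map⁺ (prefixed (q , X , q′)) i))

  ∈-expand⁻ : ∀ α {q X e} → e ∈ annotations q (inj₁ X ∷ α) →
              ∃₂ λ q′ e′ → e′ ∈ annotations q′ α × e ≡ prefixed (q , X , q′) e′
  ∈-expand⁻ α {q} {X} i
    with find (∈-concatMap⁻ (λ q′ → map (prefixed (q , X , q′)) (annotations q′ α)) {xs = states} i)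
  ... | q′ , _ , j = q′ , ∈-map⁻ (prefixed (q , X , q′)) j

  annotations-++ : ∀ β {α} q {e} → e ∈ annotations q (β ++ α) →
    ∃₂ λ e₁ e₂ → e₁ ∈ annotations q β × e₂ ∈ annotations (target e₁) α ×
      target e ≡ target e₂ × symbols e ≡ symbols e₁ ++ symbols e₂ ×
      (∀ ι → charge e ι ≡ charge e₁ ι + charge e₂ ι)
  annotations-++ [] q {e} i = _ , e , here refl , i , refl , refl , λ ι → refl
  annotations-++ (inj₂ a ∷ β) q i with ∈-map⁻ (charged (μ q a)) i
  ... | e , j , refl with annotations-++ β (δ q a) j
  ...   | e₁ , e₂ , i₁ , i₂ , t , s , c = charged (μ q a) e₁ , e₂ , ∈-map⁺ _ i₁ , i₂ , t , s ,
          λ ι → trans (cong (μ q a ι +_) (c ι)) (sym (+-assoc (μ q a ι) _ _))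
  annotations-++ (inj₁ X ∷ β) {α} q i with ∈-expand⁻ (β ++ α) i
  ... | q′ , e , j , refl with annotations-++ β {α} q′ j
  ...   | e₁ , e₂ , i₁ , i₂ , t , s , c =
          prefixed (q , X , q′) e₁ , e₂ , ∈-expand⁺ β i₁ , i₂ , t , cong (_ ∷_) s , c

  Instance : Set
  Instance = Symbol × (I → ℕ) × List Symbol

  instanceOf : Q → Nonterminal → Annotated → Instance
  instanceOf q X (annotated q′ c M) = (q , X , q′) , c , M

  instancesOf : Nonterminal × SententialForm → List Instance
  instancesOf (X , α) = concatMap (λ q → map (instanceOf q X) (annotations q α)) states

  instances : List Instance
  instances = concatMap instancesOf rules

  -- Charges are functions, so instances have no decidable equality; their indices do, and can be
  -- enumerated for Dickson's lemma.
  Rule : Set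
  Rule = Fin (length instances)

  lhs : Rule → Symbol
  lhs r = proj₁ (lookup instances r)

  ruleCharge : Rule → I → ℕ
  ruleCharge r = proj₁ (proj₂ (lookup instances r))

  rhs : Rule → List Symbol
  rhs r = proj₂ (proj₂ (lookup instances r))

  ∈-instances⁺ : ∀ {X α q e} → (X , α) ∈ rules → e ∈ annotations q α → instanceOf q X e ∈ instances
  ∈-instances⁺ {X} {α} {q} i j = ∈-concatMap⁺ instancesOf
    (lose i (∈-concatMap⁺ (λ q → map (instanceOf q X) (annotations q α)) {xs = states} (lose (all-states q) (∈-map⁺ _ j))))

  ∈-instances⁻ : ∀ {x} → x ∈ instances →
    ∃₂ λ X α → ∃₂ λ q e → (X , α) ∈ rules × e ∈ annotations q α × x ≡ instanceOf q X e
  ∈-instances⁻ i with find (∈-concatMap⁻ instancesOf i)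
  ... | (X , α) , r∈ , j with find (∈-concatMap⁻ (λ q → map (instanceOf q X) (annotations q α)) {xs = states} j)
  ...   | q , _ , l with ∈-map⁻ (instanceOf q X) l
  ...     | e , m , eq = X , α , q , e , r∈ , m , eq

  _≟ˢ_ : DecidableEquality Symbol
  _≟ˢ_ = ≡-dec _≟_ (≡-dec Fin._≟_ _≟_)

  open CommutativeGrammar _≟ˢ_ lhs rhs

  chargeOf : List Rule → I → ℕ
  chargeOf y ι = total (λ r → ruleCharge r ι) y

  -- The guessed states are those of the actual run on `w`. Each terminal is charged either to the
  -- form `α` itself or to the rule instance that introduced it.
  ⊢⇒⇛ : ∀ {α w} → α ⊢ w → ∀ q → ∃₂ λ e y → e ∈ annotations q α × target e ≡ foldl δ q w ×
         symbols e ⇛[ y ] [] × (∀ ι → weight q w ι ≡ charge e ι + chargeOf y ι)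
  ⊢⇒⇛ done q = _ , [] , here refl , refl , stop ↭-refl , λ ι → refl
  ⊢⇒⇛ (terminal {a} d) q with ⊢⇒⇛ d (δ q a)
  ... | e , y , i , t , D , c = charged (μ q a) e , y , ∈-map⁺ _ i , t , D ,
    λ ι → trans (cong (μ q a ι +_) (c ι)) (sym (+-assoc (μ q a ι) _ _))
  ⊢⇒⇛ (expand {X} {β} {α} {w} r∈ d) q with ⊢⇒⇛ d q
  ... | e , y , i , t , D , c with annotations-++ β q i
  ... | e₁ , e₂ , i₁ , i₂ , t′ , s , c′ with ∈-instances⁺ {q = q} r∈ i₁
  ... | x∈ = prefixed (q , X , target e₁) e₂ , r ∷ y ,
      ∈-expand⁺ α i₂ ,
      trans (sym t′) t ,
      fire r (↭-reflexive (cong (λ x → proj₁ x ∷ symbols e₂) r≡))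
        (subst (_⇛[ y ] []) (trans s (cong (λ x → proj₂ (proj₂ x) ++ symbols e₂) r≡)) D) ,
      weights
    where
    r : Rule
    r = index x∈
    r≡ : instanceOf q X e₁ ≡ lookup instances r
    r≡ = lookup-index x∈
    lem : ∀ a b c → a + b + c ≡ b + (a + c)
    lem = solve-∀
    open ≡-Reasoning
    weights : ∀ ι → weight q w ι ≡ charge e₂ ι + chargeOf (r ∷ y) ι
    weights ι = begin
      weight q w ι                                      ≡⟨ c ι ⟩
      charge e ι + chargeOf y ι                         ≡⟨ cong (_+ chargeOf y ι) (c′ ι) ⟩
      charge e₁ ι + charge e₂ ι + chargeOf y ι          ≡⟨ lem (charge e₁ ι) (charge e₂ ι) (chargeOf y ι) ⟩
      charge e₂ ι + (charge e₁ ι + chargeOf y ι)        ≡⟨ cong (λ x → charge e₂ ι + (proj₁ (proj₂ x) ι + chargeOf y ι)) r≡ ⟩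
      charge e₂ ι + chargeOf (r ∷ y) ι                  ∎

  Derivable : Q → SententialForm → Q → (I → ℕ) → Set
  Derivable q α q′ c = ∃[ w ] α ⊢ w × foldl δ q w ≡ q′ × (∀ ι → weight q w ι ≡ c ι)

  -- Each symbol receives a word of its own and only the weights are added up. No word is assigned
  -- to the whole list, so the notion survives permutation.
  data Generates : List Symbol → (I → ℕ) → Set where
    []  : ∀ {c} → (∀ ι → c ι ≡ 0) → Generates [] c
    _∷_ : ∀ {q X q′ M c d e} → Derivable q (inj₁ X ∷ []) q′ c × Generates M d →
          (∀ ι → e ι ≡ c ι + d ι) → Generates ((q , X , q′) ∷ M) e

  Generates-↭ : ∀ {M N c} → M ↭ N → Generates M c → Generates N c
  Generates-↭ _↭_.refl g = g
  Generates-↭ (prep _ p) ((d , g) ∷ eq) = (d , Generates-↭ p g) ∷ eq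
  Generates-↭ (swap _ _ p) (_∷_ {c = a} (d , _∷_ {c = b} {d = c} (e , g) eq′) eq) =
    (e , ((d , Generates-↭ p g) ∷ λ ι → refl)) ∷
      λ ι → trans (eq ι) (trans (cong (a ι +_) (eq′ ι)) (lem (a ι) (b ι) (c ι)))
    where
    lem : ∀ a b c → a + (b + c) ≡ b + (a + c)
    lem = solve-∀
  Generates-↭ (_↭_.trans p p′) g = Generates-↭ p′ (Generates-↭ p g)

  Generates-++⁻ : ∀ M {N c} → Generates (M ++ N) c →
                  ∃₂ λ a b → Generates M a × Generates N b × (∀ ι → c ι ≡ a ι + b ι)
  Generates-++⁻ [] g = (λ _ → 0) , _ , [] (λ _ → refl) , g , λ ι → refl
  Generates-++⁻ (_ ∷ M) (_∷_ {c = d} (x , g) eq) with Generates-++⁻ M g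
  ... | a , b , g₁ , g₂ , eq′ = _ , b , (x , g₁) ∷ (λ ι → refl) , g₂ ,
        λ ι → trans (eq ι) (trans (cong (d ι +_) (eq′ ι)) (sym (+-assoc (d ι) (a ι) (b ι))))

  annotation-sound : ∀ α {q e c} → e ∈ annotations q α → Generates (symbols e) c →
                     Derivable q α (target e) (λ ι → charge e ι + c ι)
  annotation-sound [] (here refl) ([] z) = [] , done , refl , λ ι → sym (z ι)
  annotation-sound (inj₂ a ∷ α) {q} i g with ∈-map⁻ (charged (μ q a)) i
  ... | e , j , refl with annotation-sound α j g
  ...   | w , d , t , eq = a ∷ w , terminal d , t , λ ι → trans (cong (μ q a ι +_) (eq ι)) (sym (+-assoc (μ q a ι) _ _))
  annotation-sound (inj₁ X ∷ α) {q} i g with ∈-expand⁻ α i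
  annotation-sound (inj₁ X ∷ α) {q} i (_∷_ {c = a} {d = b} ((v , d , refl , eq) , g) eq″) | q′ , e , l , refl
    with annotation-sound α l g
  ... | w , d′ , t , eq′ = v ++ w , ⊢-++ d d′ , trans (foldl-++ δ q v w) t , λ ι → begin
      weight q (v ++ w) ι                 ≡⟨ weight-++ q v w ι ⟩
      weight q v ι + weight q′ w ι        ≡⟨ cong₂ _+_ (eq ι) (eq′ ι) ⟩
      a ι + (charge e ι + b ι)            ≡⟨ lem (a ι) (charge e ι) (b ι) ⟩
      charge e ι + (a ι + b ι)            ≡⟨ cong (charge e ι +_) (eq″ ι) ⟨
      charge e ι + _                      ∎
    where
    lem : ∀ a b c → a + (b + c) ≡ b + (a + c)
    lem = solve-∀
    open ≡-Reasoning

  -- The order lost by commutation is recovered locally: the right side of each fired rule comes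
  -- from an ordered form, in which `annotation-sound` concatenates the words of its symbols.
  ⇛-sound : ∀ {M N y} → M ⇛[ y ] N → N ≡ [] → Generates M (chargeOf y)
  ⇛-sound (stop p) refl with ↭-empty-inv p
  ... | refl = [] (λ ι → refl)
  ⇛-sound (fire {y = y} r p D) refl with Generates-++⁻ (rhs r) (⇛-sound D refl)
  ... | a , b , g₁ , g₂ , eq with lookup instances r | ∈-instances⁻ (∈-lookup {xs = instances} r)
  ... | _ | X , α , q , e , r∈ , i , refl with annotation-sound α i g₁
  ...   | w , d , t , eq′ = Generates-↭ (↭-sym p) (((w , expand r∈ (subst (_⊢ w) (sym (++-identityʳ α)) d) , t , eq′) , g₂) ∷
            λ ι → trans (cong (charge e ι +_) (eq ι)) (sym (+-assoc (charge e ι) (a ι) (b ι))))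

  open Multiplicity {Rule} Fin._≟_ using (#)
  open Repetition _≟ˢ_ Fin._≟_ lhs rhs

  pumping : ∀ {q f} (w : ℕ → List A) → (∀ m → generated (w m)) → (∀ m → foldl δ q (w m) ≡ f) →
    ¬ ¬ (∃₂ λ i j → i < j × ∃[ d ] (∀ ι → weight q (w j) ι ≡ weight q (w i) ι + d ι) ×
         (∀ t → ∃[ x ] generated x × foldl δ q x ≡ f × (∀ ι → weight q x ι ≡ weight q (w i) ι + t * d ι)))
  pumping {q} {f} w gen end none = dickson (map count (allFin _) ++ map absent (allFin _)) always-infinite λ where
      (i , j , i<j , _ , _ , le) → none (i , j , i<j ,
        extract i j
          (λ r → All-lookup (++⁻ˡ (map count (allFin _)) le) (∈-map⁺ count (∈-allFin r)))
          (λ r → All-lookup (++⁻ʳ (map count (allFin _)) le) (∈-map⁺ absent (∈-allFin r))))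
    where
    -- Common end states give one root symbol for all `m`, so any two of the derivations erase the
    -- same multiset and can be compared.
    root : Symbol
    root = q , start , f

    derivation : ∀ m → ∃[ y ] root ∷ [] ⇛[ y ] [] × (∀ ι → weight q (w m) ι ≡ chargeOf y ι)
    derivation m with ⊢⇒⇛ (⇒*⇒⊢ (gen m) refl) q
    ... | e , y , i , t , D , c with ∈-expand⁻ [] i
    ... | _ , _ , here refl , refl with trans t (end m)
    ...   | refl = y , D , c

    used : ℕ → List Rule
    used m = proj₁ (derivation m)

    count absent : Rule → ℕ → ℕ
    count r m = # r (used m)
    absent r m = 1 ∸ # r (used m)

    always-infinite : Infinite (λ _ → ⊤)
    always-infinite N none = none (N , ≤-refl , tt)

    extract : ∀ i j → (∀ r → count r i ≤ count r j) → (∀ r → absent r i ≤ absent r j) →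
      ∃[ d ] (∀ ι → weight q (w j) ι ≡ weight q (w i) ι + d ι) ×
      (∀ t → ∃[ x ] generated x × foldl δ q x ≡ f × (∀ ι → weight q x ι ≡ weight q (w i) ι + t * d ι))
    extract i j le le′ with derivation i | derivation j
    ... | x , D , c | y , E , c′ with repeatDifference D E le le′
    ... | z , p , more = chargeOf z ,
      (λ ι → trans (c′ ι) (trans (total-↭ (λ r → ruleCharge r ι) p)
               (trans (total-++ (λ r → ruleCharge r ι) x z) (cong (_+ chargeOf z ι) (sym (c ι)))))) ,
      word
      where
      word : ∀ t → ∃[ v ] generated v × foldl δ q v ≡ f × (∀ ι → weight q v ι ≡ weight q (w i) ι + t * chargeOf z ι)
      word t with more t
      ... | x′ , p′ , D′ with ⇛-sound D′ refl
      ... | _∷_ {c = a} {d = b} ((v , d , t′ , eq) , [] zero-b) eq′ = v , ⊢⇒⇒* d , t′ , λ ι → begin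
          weight q v ι                                                  ≡⟨ eq ι ⟩
          a ι                                                           ≡⟨ +-identityʳ (a ι) ⟨
          a ι + 0                                                       ≡⟨ cong (a ι +_) (zero-b ι) ⟨
          a ι + b ι                                                     ≡⟨ eq′ ι ⟨
          chargeOf x′ ι                                                 ≡⟨ total-↭ (λ r → ruleCharge r ι) p′ ⟩
          chargeOf (concat (replicate t z) ++ x) ι                      ≡⟨ total-++ (λ r → ruleCharge r ι) (concat (replicate t z)) x ⟩
          chargeOf (concat (replicate t z)) ι + chargeOf x ι            ≡⟨ cong₂ _+_ (total-power (λ r → ruleCharge r ι) t z) (sym (c ι)) ⟩
          t * chargeOf z ι + weight q (w i) ι                           ≡⟨ +-comm (t * chargeOf z ι) (weight q (w i) ι) ⟩
          weight q (w i) ι + t * chargeOf z ι                           ∎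
        where open ≡-Reasoning

-- Nim

odd : ℕ → Bool
odd zero = false
odd (suc zero) = true
odd (suc (suc n)) = odd n

bit : Bool → ℕ → ℕ
bit false m = m * 2
bit true m = suc (m * 2)

odd-bit : ∀ b m → odd (bit b m) ≡ b
odd-bit false zero = refl
odd-bit true zero = refl
odd-bit false (suc m) = odd-bit false m
odd-bit true (suc m) = odd-bit true m

half-bit : ∀ b m → ⌊ bit b m /2⌋ ≡ m
half-bit false zero = refl
half-bit true zero = refl
half-bit false (suc m) = cong suc (half-bit false m)
half-bit true (suc m) = cong suc (half-bit true m)

bit-odd-half : ∀ n → bit (odd n) ⌊ n /2⌋ ≡ n
bit-odd-half zero = refl
bit-odd-half (suc zero) = refl
bit-odd-half (suc (suc n)) with odd n | bit-odd-half n
... | false | eq = cong (2 +_) eq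
... | true | eq = cong (2 +_) eq

bit-mono-< : ∀ b c {m n} → m < n → bit b m < bit c n
bit-mono-< b c {m} {n} m<n = ≤-trans (s≤s (bit≤ b)) (≤-trans (*-monoˡ-≤ 2 m<n) (≤bit c))
  where
  bit≤ : ∀ b → bit b m ≤ suc (m * 2)
  bit≤ false = n≤1+n _
  bit≤ true = ≤-refl
  ≤bit : ∀ b → n * 2 ≤ bit b n
  ≤bit false = ≤-refl
  ≤bit true = n≤1+n _

⌊/2⌋-≤ : ∀ {k N} → k ≤ suc N → ⌊ k /2⌋ ≤ N
⌊/2⌋-≤ {zero} _ = z≤n
⌊/2⌋-≤ {suc k} k≤ = ≤-pred (≤-trans (⌊n/2⌋<n k) k≤)

oddSum : ∀ {n} → Vec ℕ n → Bool
oddSum [] = false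
oddSum (x ∷ v) = odd x xor oddSum v

halves : ∀ {n} → Vec ℕ n → Vec ℕ n
halves = Vec.map ⌊_/2⌋

-- The binary digits of the heaps sum to an even number in every place.
data NimZero {n} (v : Vec ℕ n) : Set where
  zeros : (∀ h → Vec.lookup v h ≡ 0) → NimZero v
  halve : oddSum v ≡ false → NimZero (halves v) → NimZero v

oddSum-zeros : ∀ {n} (v : Vec ℕ n) → (∀ h → Vec.lookup v h ≡ 0) → oddSum v ≡ false
oddSum-zeros [] z = refl
oddSum-zeros (x ∷ v) z rewrite z zero = oddSum-zeros v (λ h → z (suc h))

NimZero⇒even : ∀ {n} {v : Vec ℕ n} → NimZero v → oddSum v ≡ false
NimZero⇒even {v = v} (zeros z) = oddSum-zeros v z
NimZero⇒even (halve e _) = e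

NimZero-halves : ∀ {n} {v : Vec ℕ n} → NimZero v → NimZero (halves v)
NimZero-halves {v = v} (zeros z) = zeros (λ h → trans (lookup-map h ⌊_/2⌋ v) (cong ⌊_/2⌋ (z h)))
NimZero-halves (halve _ z) = z

-- The witness `b` is the parity of the other heaps.
oddSum-update : ∀ {n} (v : Vec ℕ n) h → ∃[ b ] (∀ m → oddSum (v [ h ]≔ m) ≡ odd m xor b)
oddSum-update (x ∷ v) zero = oddSum v , λ m → refl
oddSum-update (x ∷ v) (suc h) with oddSum-update v h
... | b , eq = odd x xor b , λ m → trans (cong (odd x xor_) (eq m)) (xor-swap (odd x) (odd m) b)
  where
  xor-swap : ∀ a b c → a xor (b xor c) ≡ b xor (a xor c)
  xor-swap false b c = refl
  xor-swap true false c = refl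
  xor-swap true true c = refl

xor-cancelʳ : ∀ a b c → a xor c ≡ b xor c → a ≡ b
xor-cancelʳ false false c eq = refl
xor-cancelʳ true true c eq = refl
xor-cancelʳ false true false ()
xor-cancelʳ false true true ()
xor-cancelʳ true false false ()
xor-cancelʳ true false true ()

-- The other heaps determine the last digit of heap `h`, and recursively, after halving, all its
-- higher digits.
NimZero-unique : ∀ {n} {v : Vec ℕ n} h {m} → NimZero v → NimZero (v [ h ]≔ m) → m ≡ Vec.lookup v h
NimZero-unique {v = v} h {m} = go (m ⊔ Vec.lookup v h) v m (m≤m⊔n m _) (m≤n⊔m m _)
  where
  go : ∀ N v m → m ≤ N → Vec.lookup v h ≤ N → NimZero v → NimZero (v [ h ]≔ m) → m ≡ Vec.lookup v h
  go zero v m m≤ l≤ _ _ = trans (n≤0⇒n≡0 m≤) (sym (n≤0⇒n≡0 l≤))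
  go (suc N) v m m≤ l≤ z z′ = begin
    m                          ≡⟨ bit-odd-half m ⟨
    bit (odd m) ⌊ m /2⌋        ≡⟨ cong₂ bit odd≡ half≡ ⟩
    bit (odd l) ⌊ l /2⌋        ≡⟨ bit-odd-half l ⟩
    l                          ∎
    where
    open ≡-Reasoning
    l = Vec.lookup v h
    half≡ : ⌊ m /2⌋ ≡ ⌊ l /2⌋
    half≡ = trans (go N (halves v) ⌊ m /2⌋ (⌊/2⌋-≤ m≤)
                     (≤-trans (≤-reflexive (lookup-map h ⌊_/2⌋ v)) (⌊/2⌋-≤ l≤)) (NimZero-halves z)
                     (subst NimZero (map-[]≔ ⌊_/2⌋ v h) (NimZero-halves z′)))
                  (lookup-map h ⌊_/2⌋ v)
    odd≡ : odd m ≡ odd l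
    odd≡ with oddSum-update v h
    ... | b , eq = xor-cancelʳ (odd m) (odd l) b (trans (sym (eq m)) (trans (NimZero⇒even z′)
                     (trans (sym (NimZero⇒even z)) (trans (cong oddSum (sym ([]≔-lookup v h))) (eq l)))))

odd-entry : ∀ {n} (v : Vec ℕ n) → oddSum v ≡ true → ∃[ h ] odd (Vec.lookup v h) ≡ true
odd-entry (x ∷ v) p with odd x in eq
... | true = zero , eq
... | false with odd-entry v p
...   | h , q = suc h , q

-- The winning move of Bouton's theorem, found from the highest digit down. A reduction that
-- balances the halves is completed by a suitable last digit; if the halves are balanced already and
-- the parity is odd, some odd heap loses its last digit 1.
bouton : ∀ {n} (v : Vec ℕ n) → NimZero v ⊎ ∃₂ λ h m → m < Vec.lookup v h × NimZero (v [ h ]≔ m)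
bouton v = go (Vec.sum v) v (≤sum v)
  where
  ≤sum : ∀ {n} (v : Vec ℕ n) h → Vec.lookup v h ≤ Vec.sum v
  ≤sum (x ∷ v) zero = m≤m+n x _
  ≤sum (x ∷ v) (suc h) = ≤-trans (≤sum v h) (m≤n+m _ x)

  -- The new last digit is the old one, flipped exactly if the parity of `v` is odd.
  even-update : ∀ {n} (v : Vec ℕ n) h m → NimZero (halves v [ h ]≔ m) →
                NimZero (v [ h ]≔ bit (odd (Vec.lookup v h) xor oddSum v) m)
  even-update v h m z with oddSum-update v h
  ... | b , eq = halve (trans (eq _) (trans (cong (_xor b) (odd-bit (odd (Vec.lookup v h) xor oddSum v) m))
                        (lem (odd (Vec.lookup v h)) b (oddSum v) (trans (cong oddSum (sym ([]≔-lookup v h))) (eq _)))))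
                      (subst NimZero (sym (trans (map-[]≔ ⌊_/2⌋ v h)
                        (cong (halves v [ h ]≔_) (half-bit (odd (Vec.lookup v h) xor oddSum v) m)))) z)
    where
    lem : ∀ a b c → c ≡ a xor b → (a xor c) xor b ≡ false
    lem false false _ refl = refl
    lem false true _ refl = refl
    lem true false _ refl = refl
    lem true true _ refl = refl

  go : ∀ {n} N (v : Vec ℕ n) → (∀ h → Vec.lookup v h ≤ N) →
       NimZero v ⊎ ∃₂ λ h m → m < Vec.lookup v h × NimZero (v [ h ]≔ m)
  go zero v le = inj₁ (zeros (λ h → n≤0⇒n≡0 (le h)))
  go (suc N) v le with go N (halves v) le′
    where
    le′ : ∀ h → Vec.lookup (halves v) h ≤ N
    le′ h = ≤-trans (≤-reflexive (lookup-map h ⌊_/2⌋ v)) (⌊/2⌋-≤ (le h))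
  ... | inj₂ (h , m , m< , z) =
    inj₂ (h , bit (odd l xor oddSum v) m ,
          subst (bit (odd l xor oddSum v) m <_) (bit-odd-half l)
            (bit-mono-< (odd l xor oddSum v) (odd l) (subst (m <_) (lookup-map h ⌊_/2⌋ v) m<)) ,
          even-update v h m z)
    where
    l = Vec.lookup v h
  ... | inj₁ z with oddSum v in eq
  ...   | false = inj₁ (halve eq z)
  ...   | true with odd-entry v eq
  ...     | h , odd-h = inj₂ (h , _ , smaller , even-update v h ⌊ l /2⌋
              (subst NimZero (sym (trans (cong (halves v [ h ]≔_) (sym (lookup-map h ⌊_/2⌋ v))) ([]≔-lookup (halves v) h))) z))
    where
    l = Vec.lookup v h
    smaller : bit (odd l xor oddSum v) ⌊ l /2⌋ < l
    smaller rewrite odd-h | eq = ≤-reflexive (trans (cong (λ b → bit b ⌊ l /2⌋) (sym odd-h)) (bit-odd-half l))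

-- Nim-sums of the triples (x, 2x, 3x)

line : ℕ → Vec ℕ 3
line x = x ∷ x * 2 ∷ x * 3 ∷ []

halves-bits : ∀ a b c x y z → halves (bit a x ∷ bit b y ∷ bit c z ∷ []) ≡ x ∷ y ∷ z ∷ []
halves-bits a b c x y z = cong₂ _∷_ (half-bit a x) (cong₂ _∷_ (half-bit b y) (cong (_∷ []) (half-bit c z)))

oddSum-bits : ∀ a b c x y z → oddSum (bit a x ∷ bit b y ∷ bit c z ∷ []) ≡ a xor (b xor (c xor false))
oddSum-bits a b c x y z = cong₂ _xor_ (odd-bit a x) (cong₂ _xor_ (odd-bit b y) (cong (_xor false) (odd-bit c z)))

vec₃ : ∀ {x x′ y y′ z z′ : ℕ} → x ≡ x′ → y ≡ y′ → z ≡ z′ → _≡_ {A = Vec ℕ 3} (x ∷ y ∷ z ∷ []) (x′ ∷ y′ ∷ z′ ∷ [])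
vec₃ refl refl refl = refl

NimZero-bits : ∀ a b c {x y z} → a xor (b xor (c xor false)) ≡ false → NimZero (x ∷ y ∷ z ∷ []) →
               NimZero (bit a x ∷ bit b y ∷ bit c z ∷ [])
NimZero-bits a b c {x} {y} {z} e n =
  halve (trans (oddSum-bits a b c x y z) e) (subst NimZero (sym (halves-bits a b c x y z)) n)

NimZero-bits⁻ : ∀ a b c {x y z} → NimZero (bit a x ∷ bit b y ∷ bit c z ∷ []) → NimZero (x ∷ y ∷ z ∷ [])
NimZero-bits⁻ a b c {x} {y} {z} n = subst NimZero (halves-bits a b c x y z) (NimZero-halves n)

line-double : ∀ x → line (x * 2) ≡ bit false x ∷ bit false (x * 2) ∷ bit false (x * 3) ∷ []
line-double x = vec₃ refl refl (lem x)
  where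
  lem : ∀ x → x * 2 * 3 ≡ x * 3 * 2
  lem = solve-∀

NimZero-double : ∀ {x} → NimZero (line x) → NimZero (line (x * 2))
NimZero-double {x} z = subst NimZero (sym (line-double x)) (NimZero-bits false false false refl z)

NimZero-double⁻ : ∀ {x} → NimZero (line (x * 2)) → NimZero (line x)
NimZero-double⁻ {x} z = NimZero-bits⁻ false false false (subst NimZero (line-double x) z)

-- Appending the digits 01 to `x` appends 01, 10 and 11 to the three heaps, and these cancel.
NimZero-01 : ∀ {x} → NimZero (line x) → NimZero (line (1 + x * 4))
NimZero-01 {x} z = subst NimZero (vec₃ (e₁ x) (e₂ x) (e₃ x))
  (NimZero-bits true false true refl (NimZero-bits false true true refl z))
  where
  e₁ : ∀ x → suc (x * 2 * 2) ≡ 1 + x * 4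
  e₁ = solve-∀
  e₂ : ∀ x → suc (x * 2 * 2) * 2 ≡ (1 + x * 4) * 2
  e₂ = solve-∀
  e₃ : ∀ x → suc (suc (x * 3 * 2) * 2) ≡ (1 + x * 4) * 3
  e₃ = solve-∀

-- Removing two digits from each of 4x+3, 8x+6 and 12x+9 leaves x, 2x+1 and 3x+2, whose sum is odd.
¬NimZero-11 : ∀ {x} → ¬ NimZero (line (3 + x * 4))
¬NimZero-11 {x} z = absurd (NimZero⇒even (NimZero-bits⁻ true true false {x} {suc (x * 2)} {2 + x * 3}
    (NimZero-bits⁻ true false true {suc (x * 2)} {suc (suc (x * 2) * 2)} {(2 + x * 3) * 2}
      (subst NimZero (vec₃ (e₁ x) (e₂ x) (e₃ x)) z))))
  where
  e₁ : ∀ x → 3 + x * 4 ≡ suc (suc (x * 2) * 2)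
  e₁ = solve-∀
  e₂ : ∀ x → (3 + x * 4) * 2 ≡ suc (suc (x * 2) * 2) * 2
  e₂ = solve-∀
  e₃ : ∀ x → (3 + x * 4) * 3 ≡ suc ((2 + x * 3) * 2 * 2)
  e₃ = solve-∀
  odd-suc : ∀ n → odd (suc n) ≡ not (odd n)
  odd-suc zero = refl
  odd-suc (suc zero) = refl
  odd-suc (suc (suc n)) = odd-suc n
  odd-*3 : ∀ n → odd (n * 3) ≡ odd n
  odd-*3 zero = refl
  odd-*3 (suc n) = trans (odd-suc (n * 3)) (trans (cong not (odd-*3 n)) (sym (odd-suc n)))
  absurd : ¬ (oddSum (x ∷ suc (x * 2) ∷ 2 + x * 3 ∷ []) ≡ false)
  absurd eq rewrite odd-*3 x | odd-bit true x with odd x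
  absurd () | false
  absurd () | true

-- Peg Duotaire as Nim

update-same : ∀ p i b → (p [ i ≔ b ]) i ≡ b
update-same p i b with i ℤ.≟ i
... | yes _ = refl
... | no i≢i = contradiction refl i≢i

update-other : ∀ p {i j} b → j ≢ i → (p [ i ≔ b ]) j ≡ p j
update-other p {i} {j} b j≢i with j ℤ.≟ i
... | yes j≡i = contradiction j≡i j≢i
... | no _ = refl

record Hopped (p q : Position) (origin mid land : ℤ) : Set where
  field
    at-origin : q origin ≡ false
    at-mid    : q mid ≡ false
    at-land   : q land ≡ true
    elsewhere : ∀ {j} → j ≢ origin → j ≢ mid → j ≢ land → q j ≡ p j

  peg⁻ : ∀ {j} → q j ≡ true → j ≢ land → p j ≡ true × j ≢ origin × j ≢ mid
  peg⁻ {j} qj j≢l with j ℤ.≟ origin | j ℤ.≟ mid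
  ... | yes refl | _ = contradiction (trans (sym qj) at-origin) λ ()
  ... | no _ | yes refl = contradiction (trans (sym qj) at-mid) λ ()
  ... | no j≢o | no j≢m = trans (sym (elsewhere j≢o j≢m j≢l)) qj , j≢o , j≢m

hopped : ∀ p {o m l} → o ≢ m → o ≢ l → m ≢ l →
         Hopped p (((p [ o ≔ false ]) [ m ≔ false ]) [ l ≔ true ]) o m l
hopped p {o} {m} {l} o≢m o≢l m≢l = record
  { at-origin = trans (update-other p₂ true o≢l) (trans (update-other p₁ false o≢m) (update-same p o false))
  ; at-mid    = trans (update-other p₂ true m≢l) (update-same p₁ m false)
  ; at-land   = update-same p₂ l true
  ; elsewhere = λ j≢o j≢m j≢l → trans (update-other p₂ true j≢l)
                  (trans (update-other p₁ false j≢m) (update-other p false j≢o))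
  }
  where
  p₁ p₂ : Position
  p₁ = p [ o ≔ false ]
  p₂ = p₁ [ m ≔ false ]

+≢ : ∀ {m n} → m ≢ n → ⁺ m ≢ ⁺ n
+≢ m≢n eq = m≢n (ℤ.+-injective eq)

leftHopped : ∀ p x → Hopped p (afterHop p (⁺ (3 + x)) left) (⁺ (3 + x)) (⁺ (2 + x)) (⁺ (1 + x))
leftHopped p x = hopped p (+≢ 1+n≢n) (+≢ (m+1+n≢n 1)) (+≢ 1+n≢n)

rightHopped : ∀ p x → Hopped p (afterHop p (⁺ x) right) (⁺ x) (⁺ (1 + x)) (⁺ (2 + x))
rightHopped p x = subst₂ (Hopped p (afterHop p (⁺ x) right) (⁺ x)) (cong ⁺_ (+-comm x 1)) (cong ⁺_ (+-comm x 2))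
  (hopped p (+≢ (λ eq → m≢1+m+n x (trans eq (+-suc x 0)))) (+≢ (λ eq → m≢1+m+n x (trans eq (+-suc x 1))))
    (+≢ (λ eq → contradiction (+-cancelˡ-≡ x 1 2 eq) λ ())))

-- The word 0(01)ᵏ10 from site b on, followed by a hole.
record Heap (p : Position) (b k : ℕ) : Set where
  field
    base-hole : p (⁺ b) ≡ false
    even-peg  : ∀ j → 0 < j → j ≤ k → p (⁺ (j * 2 + b)) ≡ true
    odd-hole  : ∀ j → j < k → p (⁺ suc (j * 2 + b)) ≡ false
    last-peg  : p (⁺ suc (k * 2 + b)) ≡ true
    end-hole  : p (⁺ (2 + (k * 2 + b))) ≡ false
    next-hole : p (⁺ (3 + (k * 2 + b))) ≡ false
open Heap

Heap-agree : ∀ {p q b k} → (∀ m → b ≤ m → m ≤ 3 + (k * 2 + b) → q (⁺ m) ≡ p (⁺ m)) → Heap p b k → Heap q b k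
Heap-agree {p} {q} {b} {k} agree H = record
  { base-hole = trans (agree b ≤-refl (≤-trans (m≤n+m b (k * 2)) (m≤n+m _ 3))) (base-hole H)
  ; even-peg  = λ j 0<j j≤k → trans (agree _ (m≤n+m b (j * 2)) (≤-trans (mono j≤k) (m≤n+m _ 3))) (even-peg H j 0<j j≤k)
  ; odd-hole  = λ j j<k → trans (agree _ (≤-trans (m≤n+m b (j * 2)) (n≤1+n _))
                                        (s≤s (≤-trans (mono (<⇒≤ j<k)) (m≤n+m _ 2)))) (odd-hole H j j<k)
  ; last-peg  = trans (agree _ (b≤ 1) (s≤s (m≤n+m _ 2))) (last-peg H)
  ; end-hole  = trans (agree _ (b≤ 2) (n≤1+n _)) (end-hole H)
  ; next-hole = trans (agree _ (b≤ 3) ≤-refl) (next-hole H)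
  }
  where
  mono : ∀ {j} → j ≤ k → j * 2 + b ≤ k * 2 + b
  mono j≤k = +-monoˡ-≤ b (*-monoˡ-≤ 2 j≤k)
  b≤ : ∀ c → b ≤ c + (k * 2 + b)
  b≤ c = ≤-trans (m≤n+m b (k * 2)) (m≤n+m _ c)

module Game {n : ℕ} (base : Fin n → ℕ) where

  top : Vec ℕ n → Fin n → ℕ
  top v h = Vec.lookup v h * 2 + base h

  -- A heap of size 0 may have left pegs behind, but no adjacent ones.
  record Layout (v : Vec ℕ n) (p : Position) : Set where
    field
      separated : ∀ g h → g ≢ h → 3 + top v g ≤ base h ⊎ 3 + top v h ≤ base g
      heap      : ∀ h → 0 < Vec.lookup v h → Heap p (base h) (Vec.lookup v h)
      pair      : ∀ i → p i ≡ true → p (i +ᶻ 1ℤ) ≡ true → ∃[ h ] 0 < Vec.lookup v h × i ≡ ⁺ top v h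
  open Layout

  base≤top : ∀ v h → base h ≤ top v h
  base≤top v h = m≤n+m (base h) _

  lookup-update-≤ : ∀ {v : Vec ℕ n} {h m} → m ≤ Vec.lookup v h → ∀ g → Vec.lookup (v [ h ]≔ m) g ≤ Vec.lookup v g
  lookup-update-≤ {v} {h} m≤ g with g Fin.≟ h
  ... | yes refl = ≤-trans (≤-reflexive (lookup∘update g v _)) m≤
  ... | no g≢h = ≤-reflexive (lookup∘update′ g≢h v _)

  separated-update : ∀ {v p h m} → Layout v p → m ≤ Vec.lookup v h →
    ∀ f g → f ≢ g → 3 + top (v [ h ]≔ m) f ≤ base g ⊎ 3 + top (v [ h ]≔ m) g ≤ base f
  separated-update {v} {h = h} {m} L m≤ f g f≢g with separated L f g f≢g
  ... | inj₁ le = inj₁ (≤-trans (+-monoʳ-≤ 3 (+-monoˡ-≤ (base f) (*-monoˡ-≤ 2 (lookup-update-≤ {v} m≤ f)))) le)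
  ... | inj₂ le = inj₂ (≤-trans (+-monoʳ-≤ 3 (+-monoˡ-≤ (base g) (*-monoˡ-≤ 2 (lookup-update-≤ {v} m≤ g)))) le)

  -- By separation the windows of the other heaps avoid the sites strictly between `base h` and
  -- `3 + top v h`. Both bounds are non-strict, as the hole closing one window may be the base of
  -- the next.
  heap-update : ∀ {v p q h m} → Layout v p →
    (∀ j → j ≤ base h ⊎ 3 + top v h ≤ j → q (⁺ j) ≡ p (⁺ j)) →
    (0 < m → Heap q (base h) m) →
    ∀ g → 0 < Vec.lookup (v [ h ]≔ m) g → Heap q (base g) (Vec.lookup (v [ h ]≔ m) g)
  heap-update {v} {p} {q} {h} {m} L agree new g pos with g Fin.≟ h
  ... | yes refl = subst (Heap q (base h)) (sym eq) (new (subst (0 <_) eq pos))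
    where
    eq : Vec.lookup (v [ h ]≔ m) h ≡ m
    eq = lookup∘update h v m
  ... | no g≢h = subst (Heap q (base g)) (sym eq) (Heap-agree agree′ (heap L g (subst (0 <_) eq pos)))
    where
    eq : Vec.lookup (v [ h ]≔ m) g ≡ Vec.lookup v g
    eq = lookup∘update′ g≢h v m
    agree′ : ∀ j → base g ≤ j → j ≤ 3 + top v g → q (⁺ j) ≡ p (⁺ j)
    agree′ j lo hi with separated L g h g≢h
    ... | inj₁ le = agree j (inj₁ (≤-trans hi le))
    ... | inj₂ le = agree j (inj₂ (≤-trans le lo))

  +1 : ∀ m → ⁺ m +ᶻ 1ℤ ≡ ⁺ suc m
  +1 m = cong ⁺_ (+-comm m 1)

  pair-other : ∀ {v h m g i} → g ≢ h → 0 < Vec.lookup v g → i ≡ ⁺ top v g →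
               ∃[ g ] 0 < Vec.lookup (v [ h ]≔ m) g × i ≡ ⁺ top (v [ h ]≔ m) g
  pair-other {v} {h} {m} {g} g≢h pos eq = g , subst (0 <_) (sym eq′) pos ,
    trans eq (cong (λ k → ⁺ (k * 2 + base g)) (sym eq′))
    where
    eq′ : Vec.lookup (v [ h ]≔ m) g ≡ Vec.lookup v g
    eq′ = lookup∘update′ g≢h v m

  -- With `x` the new top, the last peg lands at `1 + x`, next to the peg at `x` if `k` is positive;
  -- the two sites it cleared become the closing holes of the shorter heap.
  layout-left : ∀ {v p q h k} → Layout v p → Vec.lookup v h ≡ suc k →
    let x = k * 2 + base h in Hopped p q (⁺ (3 + x)) (⁺ (2 + x)) (⁺ (1 + x)) → Layout (v [ h ]≔ k) q
  layout-left {v} {p} {q} {h} {k} L eq H = record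
    { separated = separated-update L k≤
    ; heap      = heap-update L agree new
    ; pair      = pair′
    }
    where
    open Hopped H
    b x : ℕ
    b = base h
    x = k * 2 + b
    k≤ : k ≤ Vec.lookup v h
    k≤ = subst (k ≤_) (sym eq) (n≤1+n k)
    top≡ : top v h ≡ 2 + x
    top≡ = cong (λ k → k * 2 + b) eq
    old : Heap p b (suc k)
    old = subst (Heap p b) eq (heap L h (subst (0 <_) (sym eq) z<s))
    below : ∀ j → j ≤ x → q (⁺ j) ≡ p (⁺ j)
    below j j≤x = elsewhere (+≢ (<⇒≢ (≤-trans (s≤s j≤x) (+-monoˡ-≤ x {1} {3} (s≤s z≤n)))))
                            (+≢ (<⇒≢ (≤-trans (s≤s j≤x) (+-monoˡ-≤ x {1} {2} (s≤s z≤n)))))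
                            (+≢ (<⇒≢ (s≤s j≤x)))
    above : ∀ j → 4 + x ≤ j → q (⁺ j) ≡ p (⁺ j)
    above j ≤j = elsewhere (+≢ (>⇒≢ ≤j)) (+≢ (>⇒≢ (≤-trans (n≤1+n _) ≤j))) (+≢ (>⇒≢ (≤-trans (m≤n+m _ 2) ≤j)))
    agree : ∀ j → j ≤ b ⊎ 3 + top v h ≤ j → q (⁺ j) ≡ p (⁺ j)
    agree j (inj₁ j≤b) = below j (≤-trans j≤b (m≤n+m b (k * 2)))
    agree j (inj₂ ≤j) = above j (≤-trans (n≤1+n _) (subst (λ t → 3 + t ≤ j) top≡ ≤j))
    new : 0 < k → Heap q b k
    new 0<k = record
      { base-hole = trans (below b (m≤n+m b (k * 2))) (base-hole old)
      ; even-peg  = λ j 0<j j≤k → trans (below _ (+-monoˡ-≤ b (*-monoˡ-≤ 2 j≤k))) (even-peg old j 0<j (m≤n⇒m≤1+n j≤k))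
      ; odd-hole  = λ j j<k → trans (below _ (+-monoˡ-≤ b (≤-trans (n≤1+n _) (*-monoˡ-≤ 2 j<k)))) (odd-hole old j (m≤n⇒m≤1+n j<k))
      ; last-peg  = at-land
      ; end-hole  = at-mid
      ; next-hole = at-origin
      }
    pair′ : ∀ i → q i ≡ true → q (i +ᶻ 1ℤ) ≡ true →
            ∃[ g ] 0 < Vec.lookup (v [ h ]≔ k) g × i ≡ ⁺ top (v [ h ]≔ k) g
    pair′ i qi qi+1 with i ℤ.≟ ⁺ (1 + x) | i +ᶻ 1ℤ ℤ.≟ ⁺ (1 + x)
    ... | yes refl | _ = contradiction (trans (sym qi+1) (trans (cong q (+1 (1 + x))) at-mid)) λ ()
    -- Here the landed peg is the right member of the pair. For `k = 0` its left neighbour would be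
    -- the base, which is a hole.
    ... | no _ | yes eq′ = atTop k refl
      where
      i≡x : i ≡ ⁺ x
      i≡x = ∙-cancelʳ 1ℤ i (⁺ x) (trans eq′ (sym (+1 x)))
      atTop : ∀ k′ → k ≡ k′ → ∃[ g ] 0 < Vec.lookup (v [ h ]≔ k) g × i ≡ ⁺ top (v [ h ]≔ k) g
      atTop zero refl = contradiction (trans (sym qi) (trans (cong q i≡x) (trans (below b ≤-refl) (base-hole old)))) λ ()
      atTop (suc k′) refl = h , subst (0 <_) (sym (lookup∘update h v k)) z<s ,
        trans i≡x (cong (λ k → ⁺ (k * 2 + b)) (sym (lookup∘update h v k)))
    ... | no i≢l | no i+1≢l with peg⁻ qi i≢l | peg⁻ qi+1 i+1≢l
    ... | pi , _ , i≢m | pi+1 , _ with pair L i pi pi+1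
    ...   | g , pos , i≡ with g Fin.≟ h
    ...     | yes refl = contradiction (trans i≡ (cong ⁺_ top≡)) i≢m
    ...     | no g≢h = pair-other {v} g≢h pos i≡

  -- The peg lands between the site just cleared and `next-hole`, hence isolated, and the only
  -- adjacent pair of the heap is gone.
  layout-right : ∀ {v p q h} → Layout v p → 0 < Vec.lookup v h →
    Hopped p q (⁺ top v h) (⁺ (1 + top v h)) (⁺ (2 + top v h)) → Layout (v [ h ]≔ 0) q
  layout-right {v} {p} {q} {h} L pos H = record
    { separated = separated-update L z≤n
    ; heap      = heap-update L agree (λ ())
    ; pair      = pair′
    }
    where
    open Hopped H
    x : ℕ
    x = top v h
    above : ∀ j → 3 + x ≤ j → q (⁺ j) ≡ p (⁺ j)
    above j ≤j = elsewhere (+≢ (>⇒≢ (≤-trans (m≤n+m _ 2) ≤j))) (+≢ (>⇒≢ (≤-trans (n≤1+n _) ≤j))) (+≢ (>⇒≢ ≤j))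
    0<lookup⇒base<top : base h < x
    0<lookup⇒base<top = +-monoˡ-≤ (base h) (≤-trans pos (m≤m*n _ 2))
    agree : ∀ j → j ≤ base h ⊎ 3 + x ≤ j → q (⁺ j) ≡ p (⁺ j)
    agree j (inj₁ j≤b) = elsewhere (+≢ (<⇒≢ j<x)) (+≢ (<⇒≢ (≤-trans j<x (n≤1+n _)))) (+≢ (<⇒≢ (≤-trans j<x (m≤n+m _ 2))))
      where
      j<x : j < x
      j<x = ≤-trans (s≤s j≤b) 0<lookup⇒base<top
    agree j (inj₂ ≤j) = above j ≤j
    pair′ : ∀ i → q i ≡ true → q (i +ᶻ 1ℤ) ≡ true →
            ∃[ g ] 0 < Vec.lookup (v [ h ]≔ 0) g × i ≡ ⁺ top (v [ h ]≔ 0) g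
    pair′ i qi qi+1 with i ℤ.≟ ⁺ (2 + x) | i +ᶻ 1ℤ ℤ.≟ ⁺ (2 + x)
    ... | yes refl | _ = contradiction (trans (sym qi+1) (trans (cong q (+1 (2 + x)))
                           (trans (above (3 + x) ≤-refl) (next-hole (heap L h pos))))) λ ()
    ... | no _ | yes eq = contradiction (trans (sym qi) (trans
                            (cong q (∙-cancelʳ 1ℤ i (⁺ (1 + x)) (trans eq (sym (+1 (1 + x)))))) at-mid)) λ ()
    ... | no i≢l | no i+1≢l with peg⁻ qi i≢l | peg⁻ qi+1 i+1≢l
    ... | pi , i≢o , _ | pi+1 , _ with pair L i pi pi+1
    ...   | g , pos′ , i≡ with g Fin.≟ h
    ...     | yes refl = contradiction i≡ i≢o
    ...     | no g≢h = pair-other {v} g≢h pos′ i≡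

  data Hop (v : Vec ℕ n) (i : ℤ) (q : Position) (j : ℤ) : Set where
    inward  : ∀ {h k} → Vec.lookup v h ≡ suc k → i ≡ ⁺ suc (top v h) →
              j ≡ ⁺ suc (top (v [ h ]≔ k) h) → Layout (v [ h ]≔ k) q → Hop v i q j
    outward : ∀ {h} → 0 < Vec.lookup v h → i ≡ ⁺ top v h →
              j ≡ ⁺ (2 + top v h) → Layout (v [ h ]≔ 0) q → Hop v i q j

  hop-cases : ∀ {v p i q j} → Layout v p → (p , i) ↷ (q , j) → Hop v i q j
  hop-cases {v} {p} {i} L (hop right pi pi+1 _) with pair L i pi pi+1
  ... | h , pos , refl = outward pos refl (cong ⁺_ (+-comm (top v h) 2)) (layout-right L pos (rightHopped p (top v h)))
  hop-cases {v} {p} {i} L (hop left pi pi-1 _) with pair L (i +ᶻ -1ℤ) pi-1 (subst (λ s → p s ≡ true) (sym i-1+1) pi)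
    where
    i-1+1 : i +ᶻ -1ℤ +ᶻ 1ℤ ≡ i
    i-1+1 = trans (ℤ.+-assoc i -1ℤ 1ℤ) (ℤ.+-identityʳ i)
  ... | h , pos , i-1≡ with Vec.lookup v h in eq
  hop-cases {v} {p} {i} L (hop left pi pi-1 _) | h , () , i-1≡ | zero
  hop-cases {v} {p} {i} L (hop left pi pi-1 _) | h , pos , i-1≡ | suc k
    with ∙-cancelʳ -1ℤ i (⁺ (3 + (k * 2 + base h))) i-1≡
  ... | refl = inward eq (cong (λ k → ⁺ suc (k * 2 + base h)) (sym eq))
                 (cong (λ k → ⁺ suc (k * 2 + base h)) (sym (lookup∘update h v k)))
                 (layout-left L eq (leftHopped p (k * 2 + base h)))

  InPair : Vec ℕ n → Fin n → ℤ → Set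
  InPair v h i = ∃[ c ] c ≤ 1 × i ≡ ⁺ (c + top v h)

  -- A hop ends at offset 1 or 2 from the top of its heap and starts at offset 0 or 1, while
  -- distinct tops differ by at least 3.
  far-apart : ∀ {a c s t} → a ≤ 2 → c ≤ 1 → 3 + s ≤ t ⊎ 3 + t ≤ s → a + s ≢ c + t
  far-apart {a} {c} {s} {t} a≤ c≤ (inj₁ le) eq =
    <-irrefl eq (≤-trans (s≤s (+-monoˡ-≤ s a≤)) (≤-trans le (m≤n+m t c)))
  far-apart {a} {c} {s} {t} a≤ c≤ (inj₂ le) eq =
    <-irrefl (sym eq) (≤-trans (s≤s (+-monoˡ-≤ t c≤)) (≤-trans (≤-trans (n≤1+n _) le) (m≤n+m s a)))

  separated-tops : ∀ {v p g h} → Layout v p → g ≢ h → 3 + top v g ≤ top v h ⊎ 3 + top v h ≤ top v g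
  separated-tops {v} {g = g} {h} L g≢h with separated L g h g≢h
  ... | inj₁ le = inj₁ (≤-trans le (base≤top v h))
  ... | inj₂ le = inj₂ (≤-trans le (base≤top v g))

  -- The hopping peg cannot change heaps, by `far-apart`. Inward hops accumulate to a single
  -- reduction; after an outward hop the heap is 0 and the peg is stuck.
  moves-are-nim : ∀ {v p i q j} → Layout v p → TransClosure _↷_ (p , i) (q , j) →
    ∃₂ λ h m → m < Vec.lookup v h × Layout (v [ h ]≔ m) q × InPair v h i
  moves-are-nim L [ s ] with hop-cases L s
  ... | inward {h} {k} eq i≡ _ L′ = h , k , subst (k <_) (sym eq) ≤-refl , L′ , 1 , ≤-refl , i≡
  ... | outward {h} pos i≡ _ L′ = h , 0 , pos , L′ , 0 , z≤n , i≡
  moves-are-nim {v} L (_∷_ {y = p′ , _} s t) with hop-cases L s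
  moves-are-nim {v} L (_∷_ {y = p′ , _} s t) | inward {h} {k} eq i≡ j≡ L′ with moves-are-nim L′ t
  ... | g , m , m< , L″ , c , c≤ , j≡′ with g Fin.≟ h
  ...   | yes refl = h , m , ≤-trans (subst (m <_) (lookup∘update h v k) m<) (subst (k ≤_) (sym eq) (n≤1+n k)) ,
                     subst (λ u → Layout u _) ([]≔-idempotent v h) L″ , 1 , ≤-refl , i≡
  ...   | no g≢h = contradiction (ℤ.+-injective (trans (sym j≡) j≡′))
                     (far-apart {1} (s≤s z≤n) c≤ (separated-tops L′ (≢-sym g≢h)))
  moves-are-nim {v} L (_∷_ {y = p′ , _} s t) | outward {h} pos i≡ j≡ L′ with moves-are-nim L′ t
  ... | g , m , m< , L″ , c , c≤ , j≡′ with g Fin.≟ h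
  ...   | yes refl = contradiction (subst (m <_) (lookup∘update h v 0) m<) λ ()
  ...   | no g≢h = contradiction (ℤ.+-injective (trans (sym j≡) (trans j≡′
                       (cong (λ k → ⁺ (c + (k * 2 + base g))) (lookup∘update′ g≢h v 0)))))
                     (far-apart {2} ≤-refl c≤ (separated-tops L (≢-sym g≢h)))

  -- The last peg makes `suc k ∸ m` hops to the left. Each landing site is by computation the
  -- starting site for the next smaller heap.
  nim-moves : ∀ k {v p h m} → Layout v p → Vec.lookup v h ≡ suc k → m ≤ k →
    ∃₂ λ q j → TransClosure _↷_ (p , ⁺ (3 + (k * 2 + base h))) (q , j) × Layout (v [ h ]≔ m) q
  nim-moves k {v} {p} {h} {m} L eq m≤k = continue (m≤n⇒m<n∨m≡n m≤k)
    where
    H : Heap p (base h) (suc k)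
    H = subst (Heap p (base h)) eq (heap L h (subst (0 <_) (sym eq) z<s))
    x : ℕ
    x = k * 2 + base h
    L′ : Layout (v [ h ]≔ k) (afterHop p (⁺ (3 + x)) left)
    L′ = layout-left L eq (leftHopped p x)
    s : (p , ⁺ (3 + x)) ↷ (afterHop p (⁺ (3 + x)) left , ⁺ (1 + x))
    s = hop left (last-peg H) (even-peg H (suc k) z<s ≤-refl) (odd-hole H k ≤-refl)
    continue : m < k ⊎ m ≡ k → _
    continue (inj₂ refl) = _ , _ , [ s ] , L′
    continue (inj₁ (s≤s {n = k′} m≤k′)) with nim-moves k′ L′ (lookup∘update h v k) m≤k′
    ... | q , j , t , L″ = q , j , s ∷ t , subst (λ u → Layout u q) ([]≔-idempotent v h) L″

  nim-move : ∀ {v p h m} → Layout v p → m < Vec.lookup v h → ∃[ q ] Move p q × Layout (v [ h ]≔ m) q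
  nim-move {v} {h = h} L m< with Vec.lookup v h in eq
  nim-move L (s≤s m≤k) | suc k with nim-moves k L eq m≤k
  ... | q , j , t , L′ = q , (_ , j , t) , L′

  sum-update : ∀ {n} (v : Vec ℕ n) h {m} → m < Vec.lookup v h → Vec.sum (v [ h ]≔ m) < Vec.sum v
  sum-update (x ∷ v) zero m< = +-monoˡ-< (Vec.sum v) m<
  sum-update (x ∷ v) (suc h) m< = +-monoʳ-< x (sum-update v h m<)

  -- No move keeps the nim-sum zero, by `NimZero-unique`, and `bouton` supplies a reply restoring
  -- it. The total heap size decreases throughout.
  NimZero⇒IsP : ∀ {v p} → Layout v p → NimZero v → IsP p
  NimZero⇒IsP {v} = go (Vec.sum v) v ≤-refl
    where
    go : ∀ N v {p} → Vec.sum v ≤ N → Layout v p → NimZero v → IsP p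
    go N v sum≤ L z = everyMoveToN answer
      where
      answer : ∀ q → Move _ q → IsN q
      answer q (i , j , t) with moves-are-nim L t
      ... | h , m , m< , L′ , _ with bouton (v [ h ]≔ m)
      ... | inj₁ z′ = contradiction (NimZero-unique h z z′) (<⇒≢ m<)
      ... | inj₂ (g , m′ , m′< , z′) with nim-move L′ m′<
      ... | r , move , L″ = someMoveToP r move (recurse N sum≤)
        where
        recurse : ∀ N → Vec.sum v ≤ N → IsP r
        recurse zero le = contradiction (≤-trans (sum-update v h m<) le) λ ()
        recurse (suc N) le = go N (v [ h ]≔ m [ g ]≔ m′)
          (≤-trans (<⇒≤ (sum-update (v [ h ]≔ m) g m′<)) (≤-pred (≤-trans (sum-update v h m<) le))) L″ z′

  ¬NimZero⇒IsN : ∀ {v p} → Layout v p → ¬ NimZero v → IsN p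
  ¬NimZero⇒IsN {v} L nz with bouton v
  ... | inj₁ z = contradiction z nz
  ... | inj₂ (h , m , m< , z) with nim-move L m<
  ...   | q , move , L′ = someMoveToP q move (NimZero⇒IsP L′ z)

-- Words

core : ℕ → Word
core zero = true ∷ false ∷ []
core (suc k) = false ∷ true ∷ core k

block : ℕ → Word
block k = false ∷ core k

word : ∀ {n} → Vec ℕ n → Word
word [] = []
word (k ∷ v) = block k ++ word v

base : ∀ {n} → Vec ℕ n → Fin n → ℕ
base (k ∷ v) zero = 0
base (k ∷ v) (suc h) = 3 + k * 2 + base v h

at-core-++ : ∀ k w m → at (core k ++ w) (2 + k * 2 + m) ≡ at w m
at-core-++ zero w m = refl
at-core-++ (suc k) w m = at-core-++ k w m

word-head : ∀ {n} (v : Vec ℕ n) → at (word v) 0 ≡ false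
word-head [] = refl
word-head (k ∷ v) = refl

block-heap : ∀ k w → at w 0 ≡ false → Heap ⟦ block k ++ w ⟧ 0 k
block-heap k w w₀ = record
  { base-hole = refl
  ; even-peg  = λ { (suc j) _ j<k → even k j j<k }
  ; odd-hole  = odd′ k
  ; last-peg  = last k
  ; end-hole  = end k
  ; next-hole = trans (at-core-++ k w 0) w₀
  }
  where
  even : ∀ k j → j < k → at (core k ++ w) (suc (j * 2 + 0)) ≡ true
  even (suc k) zero j<k = refl
  even (suc k) (suc j) (s≤s j<k) = even k j j<k
  odd′ : ∀ k j → j < k → at (core k ++ w) (j * 2 + 0) ≡ false
  odd′ (suc k) zero j<k = refl
  odd′ (suc k) (suc j) (s≤s j<k) = odd′ k j j<k
  last : ∀ k → at (core k ++ w) (k * 2 + 0) ≡ true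
  last zero = refl
  last (suc k) = last k
  end : ∀ k → at (core k ++ w) (suc (k * 2 + 0)) ≡ false
  end zero = refl
  end (suc k) = end k

site-shift : ∀ c j l b → c + (j * 2 + (3 + l * 2 + b)) ≡ 3 + l * 2 + (c + (j * 2 + b))
site-shift = solve-∀

Heap-shift : ∀ l {w b k} → Heap ⟦ w ⟧ b k → Heap ⟦ block l ++ w ⟧ (3 + l * 2 + b) k
Heap-shift l {w} {b} {k} H = record
  { base-hole = trans (at-core-++ l w b) (Heap.base-hole H)
  ; even-peg  = λ j 0<j j≤k → trans (shifted 0 j) (Heap.even-peg H j 0<j j≤k)
  ; odd-hole  = λ j j<k → trans (shifted 1 j) (Heap.odd-hole H j j<k)
  ; last-peg  = trans (shifted 1 k) (Heap.last-peg H)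
  ; end-hole  = trans (shifted 2 k) (Heap.end-hole H)
  ; next-hole = trans (shifted 3 k) (Heap.next-hole H)
  }
  where
  shifted : ∀ c j → at (block l ++ w) (c + (j * 2 + (3 + l * 2 + b))) ≡ at w (c + (j * 2 + b))
  shifted c j = trans (cong (at (block l ++ w)) (site-shift c j l b)) (at-core-++ l w _)

word-heap : ∀ {n} (v : Vec ℕ n) h → Heap ⟦ word v ⟧ (base v h) (Vec.lookup v h)
word-heap (k ∷ v) zero = block-heap k (word v) (word-head v)
word-heap (k ∷ v) (suc h) = Heap-shift k (word-heap v h)

word-separated : ∀ {n} (v : Vec ℕ n) g h → g ≢ h →
  3 + (Vec.lookup v g * 2 + base v g) ≤ base v h ⊎ 3 + (Vec.lookup v h * 2 + base v h) ≤ base v g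
word-separated (k ∷ v) zero zero g≢h = contradiction refl g≢h
word-separated (k ∷ v) zero (suc h) _ = inj₁ (+-monoʳ-≤ 3 (+-monoʳ-≤ (k * 2) z≤n))
word-separated (k ∷ v) (suc g) zero _ = inj₂ (+-monoʳ-≤ 3 (+-monoʳ-≤ (k * 2) z≤n))
word-separated (k ∷ v) (suc g) (suc h) g≢h with word-separated v g h (λ eq → g≢h (cong suc eq))
... | inj₁ le = inj₁ (≤-trans (≤-reflexive (site-shift 3 (Vec.lookup v g) k (base v g))) (+-monoʳ-≤ (3 + k * 2) le))
... | inj₂ le = inj₂ (≤-trans (≤-reflexive (site-shift 3 (Vec.lookup v h) k (base v h))) (+-monoʳ-≤ (3 + k * 2) le))

-- No pair straddles the end of `core k`, since its last letter is a hole.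
core-pair : ∀ k w m → at (core k ++ w) m ≡ true → at (core k ++ w) (suc m) ≡ true →
            (∃[ l ] k ≡ suc l × m ≡ suc (l * 2)) ⊎ (∃[ m′ ] m ≡ 2 + k * 2 + m′)
core-pair zero w (suc (suc m)) _ _ = inj₂ (m , refl)
core-pair (suc zero) w (suc zero) _ _ = inj₁ (0 , refl , refl)
core-pair (suc k) w (suc (suc m)) e e′ with core-pair k w m e e′
... | inj₁ (l , refl , refl) = inj₁ (suc l , refl , refl)
... | inj₂ (m′ , refl) = inj₂ (m′ , refl)

word-pair : ∀ {n} (v : Vec ℕ n) m → at (word v) m ≡ true → at (word v) (suc m) ≡ true →
            ∃[ h ] 0 < Vec.lookup v h × m ≡ Vec.lookup v h * 2 + base v h
word-pair (k ∷ v) (suc m) e e′ with core-pair k (word v) m e e′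
... | inj₁ (l , refl , refl) = zero , z<s , sym (+-identityʳ _)
... | inj₂ (m′ , refl)
  with word-pair v m′ (trans (sym (at-core-++ k (word v) m′)) e)
         (trans (sym (at-core-++ k (word v) (suc m′))) (trans (cong (at (core k ++ word v)) (+-suc (2 + k * 2) m′)) e′))
...   | h , pos , refl = suc h , pos , sym (site-shift 0 (Vec.lookup v h) k (base v h))

word-layout : ∀ {n} (v : Vec ℕ n) → Game.Layout (base v) v ⟦ word v ⟧
word-layout v = record
  { separated = word-separated v
  ; heap      = λ h _ → word-heap v h
  ; pair      = pair
  }
  where
  pair : ∀ i → ⟦ word v ⟧ i ≡ true → ⟦ word v ⟧ (i +ᶻ 1ℤ) ≡ true →
         ∃[ h ] 0 < Vec.lookup v h × i ≡ ⁺ (Vec.lookup v h * 2 + base v h)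
  pair (⁺ m) e e′ with word-pair v m e (trans (cong (at (word v)) (+-comm 1 m)) e′)
  ... | h , pos , eq = h , pos , cong ⁺_ eq

NimZero⇒P-word : ∀ {n} {v : Vec ℕ n} → NimZero v → P-words (word v)
NimZero⇒P-word {v = v} = Game.NimZero⇒IsP (base v) (word-layout v)

¬NimZero⇒N-word : ∀ {n} {v : Vec ℕ n} → ¬ NimZero v → N-words (word v)
¬NimZero⇒N-word {v = v} nz = IsN⇒¬IsP (Game.¬NimZero⇒IsN (base v) (word-layout v) nz)

-- An automaton for concatenations of three blocks

State : Set
State = Maybe (Fin 4 × Fin 4)

_≟-State_ : DecidableEquality State
_≟-State_ = Maybe.≡-dec (≡-dec Fin._≟_ Fin._≟_)

states : List State
states = nothing ∷ map just (cartesianProduct (allFin 4) (allFin 4))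

all-states : ∀ q → q ∈ states
all-states nothing = here refl
all-states (just (s , φ)) = there (∈-map⁺ just (∈-cartesianProduct⁺ (∈-allFin s) (∈-allFin φ)))

next : Fin 4 → State
next 0F = just (1F , 0F)
next 1F = just (2F , 0F)
next 2F = just (3F , 0F)
next 3F = nothing

-- In state (s , φ) exactly s blocks are complete, and φ = 0, 1, 2, 3 says that
-- of the current block ε, 0(01)ᵏ, 0(01)ᵏ0 or 0(01)ᵏ1 has been read.
δ : State → Bool → State
δ (just (s , 0F)) false = just (s , 1F)
δ (just (s , 1F)) false = just (s , 2F)
δ (just (s , 1F)) true  = just (s , 3F)
δ (just (s , 2F)) true  = just (s , 1F)
δ (just (s , 3F)) false = next s
δ _               _     = nothing

-- The charged transition completes a factor 01 of block `s`, so the counters of an accepted word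
-- are its heap sizes.
μ : State → Bool → Fin 4 → ℕ
μ (just (s , 2F)) true ι = if does (ι Fin.≟ s) then 1 else 0
μ _               _    _ = 0

open Weighted δ μ

initial final : State
initial = just (0F , 0F)
final   = just (3F , 0F)

stuck : ∀ w → foldl δ nothing w ≢ final
stuck (a ∷ w) = stuck w

parse-core : ∀ s w → foldl δ (just (s , 1F)) w ≡ final →
             ∃₂ λ k w′ → w ≡ core k ++ w′ × foldl δ (next s) w′ ≡ final
parse-core s (true ∷ true ∷ w) eq = contradiction eq (stuck w)
parse-core s (true ∷ false ∷ w) eq = 0 , w , refl , eq
parse-core s (false ∷ false ∷ w) eq = contradiction eq (stuck w)
parse-core s (false ∷ true ∷ w) eq with parse-core s w eq
... | k , w′ , refl , eq′ = suc k , w′ , refl , eq′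

parse-block : ∀ s w → s ≢ 3F → foldl δ (just (s , 0F)) w ≡ final →
              ∃₂ λ k w′ → w ≡ block k ++ w′ × foldl δ (next s) w′ ≡ final
-- From `3F` the empty word would already be accepted.
parse-block s [] s≢ refl = contradiction refl s≢
parse-block s (true ∷ w) s≢ eq = contradiction eq (stuck w)
parse-block s (false ∷ w) s≢ eq with parse-core s w eq
... | k , w′ , refl , eq′ = k , w′ , refl , eq′

parse-end : ∀ w → foldl δ final w ≡ final → w ≡ []
parse-end [] eq = refl
parse-end (true ∷ w) eq = contradiction eq (stuck w)
parse-end (false ∷ w) eq with parse-core 3F w eq
... | k , w′ , _ , eq′ = contradiction eq′ (stuck w′)

parse : ∀ w → foldl δ initial w ≡ final → ∃[ v ] w ≡ word {3} v
parse w eq with parse-block 0F w (λ ()) eq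
... | a , w₁ , refl , eq₁ with parse-block 1F w₁ (λ ()) eq₁
... | b , w₂ , refl , eq₂ with parse-block 2F w₂ (λ ()) eq₂
... | c , w₃ , refl , eq₃ with parse-end w₃ eq₃
... | refl = a ∷ b ∷ c ∷ [] , refl

foldl-core : ∀ s k w → foldl δ (just (s , 1F)) (core k ++ w) ≡ foldl δ (next s) w
foldl-core s zero w = refl
foldl-core s (suc k) w = foldl-core s k w

foldl-word : ∀ (v : Vec ℕ 3) → foldl δ initial (word v) ≡ final
foldl-word (a ∷ b ∷ c ∷ []) =
  trans (foldl-core 0F a _) (trans (foldl-core 1F b _) (foldl-core 2F c []))

weight-core : ∀ s k w ι → weight (just (s , 1F)) (core k ++ w) ι ≡
              k * (if does (ι Fin.≟ s) then 1 else 0) + weight (next s) w ι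
weight-core s zero w ι = refl
weight-core s (suc k) w ι = trans (cong (_ +_) (weight-core s k w ι)) (sym (+-assoc (if does (ι Fin.≟ s) then 1 else 0) _ _))

weight-word : ∀ a b c ι → weight initial (word (a ∷ b ∷ c ∷ [])) ι ≡
  a * (if does (ι Fin.≟ 0F) then 1 else 0) + (b * (if does (ι Fin.≟ 1F) then 1 else 0) +
    (c * (if does (ι Fin.≟ 2F) then 1 else 0) + 0))
weight-word a b c ι =
  trans (weight-core 0F a _ ι) (cong (_ +_) (trans (weight-core 1F b _ ι) (cong (_ +_) (weight-core 2F c [] ι))))

weight-word₀ : ∀ a b c → weight initial (word (a ∷ b ∷ c ∷ [])) 0F ≡ a
weight-word₀ a b c = trans (weight-word a b c 0F) (lem a b c)
  where
  lem : ∀ a b c → a * 1 + (b * 0 + (c * 0 + 0)) ≡ a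
  lem = solve-∀

weight-word₁ : ∀ a b c → weight initial (word (a ∷ b ∷ c ∷ [])) 1F ≡ b
weight-word₁ a b c = trans (weight-word a b c 1F) (lem a b c)
  where
  lem : ∀ a b c → a * 0 + (b * 1 + (c * 0 + 0)) ≡ b
  lem = solve-∀

weight-word₂ : ∀ a b c → weight initial (word (a ∷ b ∷ c ∷ [])) 2F ≡ c
weight-word₂ a b c = trans (weight-word a b c 2F) (lem a b c)
  where
  lem : ∀ a b c → a * 0 + (b * 0 + (c * 1 + 0)) ≡ c
  lem = solve-∀

-- The automaton keeps the pumped words among three-block words, which their counts determine. As
-- the difference of two triples on the line, `d` is proportional to (1, 2, 3), so pumping stays on
-- the line.
line-pumping : ∀ {L} → ContextFree L → (x : ℕ → ℕ) → (∀ m → L (word (line (x m)))) →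
  ¬ ¬ (∃₂ λ i j → i < j × ∃[ d ] x j ≡ x i + d × (∀ t → L (word (line (x i + t * d)))))
line-pumping {L} (G , L⊆G , G⊆L) x inL none =
  pumping {initial} {final} (λ m → word (line (x m))) (λ m → L⊆G (inL m)) (λ m → foldl-word (line (x m)))
    λ where
      (i , j , i<j , d , eq , pumped) → none (i , j , i<j , d 0F , step₀ i j (d 0F) (eq 0F) ,
        λ t → onLine i j d eq t (pumped t))
  where
  open Annotation G _≟-State_ states all-states δ μ
  W : ℕ → Fin 4 → ℕ
  W m = weight initial (word (line (x m)))
  W₀ : ∀ m → W m 0F ≡ x m
  W₀ m = weight-word₀ (x m) _ _
  W₁ : ∀ m → W m 1F ≡ x m * 2
  W₁ m = weight-word₁ (x m) _ _
  W₂ : ∀ m → W m 2F ≡ x m * 3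
  W₂ m = weight-word₂ (x m) _ _
  step₀ : ∀ i j e → W j 0F ≡ W i 0F + e → x j ≡ x i + e
  step₀ i j e eq = trans (sym (W₀ j)) (trans eq (cong (_+ e) (W₀ i)))
  multiple : ∀ {i j e e′} k → x j ≡ x i + e → x j * k ≡ x i * k + e′ → e′ ≡ e * k
  multiple {i} {j} {e} {e′} k eq eq′ = +-cancelˡ-≡ (x i * k) _ _
    (trans (sym eq′) (trans (cong (_* k) eq) (*-distribʳ-+ k (x i) e)))
  lem : ∀ a t e k → a * k + t * (e * k) ≡ (a + t * e) * k
  lem = solve-∀
  onLine : ∀ i j d → (∀ ι → W j ι ≡ W i ι + d ι) → ∀ t →
    ∃[ y ] CFG.generated G y × foldl δ initial y ≡ final × (∀ ι → weight initial y ι ≡ W i ι + t * d ι) →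
    L (word (line (x i + t * d 0F)))
  onLine i j d eq t (y , gen , end , wt) with parse y end
  ... | a ∷ b ∷ c ∷ [] , refl = subst (λ v → L (word v)) (vec₃ a≡ b≡ c≡) (G⊆L gen)
    where
    d₁ : d 1F ≡ d 0F * 2
    d₁ = multiple 2 (step₀ i j (d 0F) (eq 0F)) (trans (sym (W₁ j)) (trans (eq 1F) (cong (_+ d 1F) (W₁ i))))
    d₂ : d 2F ≡ d 0F * 3
    d₂ = multiple 3 (step₀ i j (d 0F) (eq 0F)) (trans (sym (W₂ j)) (trans (eq 2F) (cong (_+ d 2F) (W₂ i))))
    a≡ : a ≡ x i + t * d 0F
    a≡ = trans (sym (weight-word₀ a b c)) (trans (wt 0F) (cong (_+ t * d 0F) (W₀ i)))
    b≡ : b ≡ (x i + t * d 0F) * 2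
    b≡ = trans (sym (weight-word₁ a b c)) (trans (wt 1F) (trans (cong₂ _+_ (W₁ i) (cong (t *_) d₁)) (lem (x i) t (d 0F) 2)))
    c≡ : c ≡ (x i + t * d 0F) * 3
    c≡ = trans (sym (weight-word₂ a b c)) (trans (wt 2F) (trans (cong₂ _+_ (W₂ i) (cong (t *_) d₂)) (lem (x i) t (d 0F) 3)))

-- Failure of context-freeness

NimZero-*2^ : ∀ i {x} → NimZero (line x) → NimZero (line (x * 2 ^ i))
NimZero-*2^ zero {x} z = subst (λ y → NimZero (line y)) (sym (*-identityʳ x)) z
NimZero-*2^ (suc i) {x} z = subst (λ y → NimZero (line y)) (lem x (2 ^ i)) (NimZero-double (NimZero-*2^ i z))
  where
  lem : ∀ x p → x * p * 2 ≡ x * (2 * p)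
  lem = solve-∀

NimZero-*2^⁻ : ∀ i {x} → NimZero (line (x * 2 ^ i)) → NimZero (line x)
NimZero-*2^⁻ zero {x} z = subst (λ y → NimZero (line y)) (*-identityʳ x) z
NimZero-*2^⁻ (suc i) {x} z = NimZero-*2^⁻ i (NimZero-double⁻ (subst (λ y → NimZero (line y)) (lem x (2 ^ i)) z))
  where
  lem : ∀ x p → x * (2 * p) ≡ x * p * 2
  lem = solve-∀

NimZero-1 : NimZero (line 1)
NimZero-1 = NimZero-01 {0} (zeros λ { 0F → refl ; 1F → refl ; 2F → refl })

NimZero-2^ : ∀ i → NimZero (line (2 ^ i))
NimZero-2^ i = subst (λ y → NimZero (line y)) (*-identityˡ (2 ^ i)) (NimZero-*2^ i NimZero-1)

-- Here `e` is `j ∸ i ∸ 1`, and the quotient q of the two powers appears as `2 + r * 2`, so that q -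
-- 1 needs no subtraction.
2^-factor : ∀ {i j} → i < j → ∃₂ λ e r → 2 ^ e ≡ suc r × 2 ^ j ≡ (2 + r * 2) * 2 ^ i
2^-factor {i} {j} i<j with m≤n⇒∃[o]m+o≡n i<j
... | e , refl with 2 ^ e in eq | m^n>0 2 e
... | suc r | _ = e , r , eq , (begin
    2 ^ (suc i + e)           ≡⟨ ^-distribˡ-+-* 2 (suc i) e ⟩
    2 * 2 ^ i * 2 ^ e         ≡⟨ cong (2 * 2 ^ i *_) eq ⟩
    2 * 2 ^ i * suc r         ≡⟨ lem (2 ^ i) r ⟩
    (2 + r * 2) * 2 ^ i       ∎)
  where
  open ≡-Reasoning
  lem : ∀ p r → 2 * p * suc r ≡ (2 + r * 2) * p
  lem = solve-∀

-- With q = 2 ^ (j ∸ i), two pumping steps from 2 ^ i lead to (2q − 1) 2 ^ i.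
P-words-not-CF : ¬ ContextFree P-words
P-words-not-CF cf = line-pumping cf (2 ^_) (λ m → NimZero⇒P-word (NimZero-2^ m)) λ where
    (i , j , i<j , d , eq , pumped) → refute i j d i<j eq (pumped 2)
  where
  refute : ∀ i j d → i < j → 2 ^ j ≡ 2 ^ i + d → ¬ P-words (word (line (2 ^ i + 2 * d)))
  refute i j d i<j eq with 2^-factor i<j
  -- In terms of `r`, 2q - 1 is `3 + r * 4`, which ends in the binary digits 11.
  ... | e , r , _ , eq′ = ¬NimZero⇒N-word λ z →
      ¬NimZero-11 {r} (NimZero-*2^⁻ i (subst (λ y → NimZero (line y))
        (trans (cong (λ d → 2 ^ i + 2 * d) d≡) (lem′ (2 ^ i) r)) z))
    where
    lem : ∀ p r → (2 + r * 2) * p ≡ p + (1 + r * 2) * p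
    lem = solve-∀
    lem′ : ∀ p r → p + 2 * ((1 + r * 2) * p) ≡ (3 + r * 4) * p
    lem′ = solve-∀
    d≡ : d ≡ (1 + r * 2) * 2 ^ i
    d≡ = +-cancelˡ-≡ (2 ^ i) _ _ (trans (sym eq) (trans eq′ (lem (2 ^ i) r)))

-- For q = 2 · 2ᵉ this makes (q² + 2)/3 an integer, so that the number of pumping steps used for
-- `N-words` is one too.
thirds : ∀ e → ∃[ g ] 3 * g ≡ 2 + 2 ^ e * 2 ^ e * 4
thirds zero = 2 , refl
thirds (suc e) with thirds e
... | g , eq = g + 2 ^ e * 2 ^ e * 4 , (begin
    3 * (g + 2 ^ e * 2 ^ e * 4)                             ≡⟨ lem g (2 ^ e) ⟩
    3 * g + 2 ^ e * 2 ^ e * 12                              ≡⟨ cong (_+ 2 ^ e * 2 ^ e * 12) eq ⟩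
    2 + 2 ^ e * 2 ^ e * 4 + 2 ^ e * 2 ^ e * 12              ≡⟨ lem′ (2 ^ e) ⟩
    2 + 2 * 2 ^ e * (2 * 2 ^ e) * 4                         ∎)
  where
  open ≡-Reasoning
  lem : ∀ g p → 3 * (g + p * p * 4) ≡ 3 * g + p * p * 12
  lem = solve-∀
  lem′ : ∀ p → 2 + p * p * 4 + p * p * 12 ≡ 2 + 2 * p * (2 * p) * 4
  lem′ = solve-∀

-- With q = 2 ^ (j ∸ i), the number of steps (q + 1)(q² + 2)/3 leads from
-- 3 · 2 ^ i to (3 + (q² − 1)(q² + 2)) 2 ^ i = (1 + q² + q⁴) 2 ^ i.
N-words-not-CF : ¬ ContextFree N-words
N-words-not-CF cf = line-pumping cf (λ m → 3 * 2 ^ m) inN λ where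
    (i , j , i<j , d , eq , pumped) → refute i j d i<j eq pumped
  where
  inN : ∀ m → N-words (word (line (3 * 2 ^ m)))
  inN m = ¬NimZero⇒N-word λ z → ¬NimZero-11 {0} (NimZero-*2^⁻ m z)
  refute : ∀ i j d → i < j → 3 * 2 ^ j ≡ 3 * 2 ^ i + d → ¬ (∀ t → N-words (word (line (3 * 2 ^ i + t * d))))
  refute i j d i<j eq pumped with 2^-factor i<j
  ... | e , r , r≡ , eq′ with thirds e
  ... | g , g≡ = pumped ((3 + r * 2) * g) (NimZero⇒P-word (subst (λ y → NimZero (line y)) (sym value) z))
    where
    s : ℕ
    s = 2 ^ e * 2 ^ e
    s≡ : s ≡ 2 ^ (e + e)
    s≡ = sym (^-distribˡ-+-* 2 e e)
    scaled : ∀ {x} → NimZero (line x) → NimZero (line (x * s))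
    scaled {x} z = subst (λ p → NimZero (line (x * p))) (sym s≡) (NimZero-*2^ (e + e) z)
    -- With `s` = q²/4, each round shifts by `e + e` zeros and appends 01, so 1 + q² + q⁴ is built
    -- without adjacent digits 1.
    z : NimZero (line ((1 + (1 + 1 * s * 4) * s * 4) * 2 ^ i))
    z = NimZero-*2^ i (NimZero-01 (scaled (NimZero-01 (scaled NimZero-1))))
    lem : ∀ p r → 3 * ((2 + r * 2) * p) ≡ 3 * p + 3 * ((1 + r * 2) * p)
    lem = solve-∀
    d≡ : d ≡ 3 * ((1 + r * 2) * 2 ^ i)
    d≡ = +-cancelˡ-≡ (3 * 2 ^ i) _ _ (trans (sym eq) (trans (cong (3 *_) eq′) (lem (2 ^ i) r)))
    regroup : ∀ p r g → 3 * p + (3 + r * 2) * g * (3 * ((1 + r * 2) * p)) ≡ (3 + (3 + r * 2) * (1 + r * 2) * (3 * g)) * p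
    regroup = solve-∀
    final-form : ∀ p r → (3 + (3 + r * 2) * (1 + r * 2) * (2 + suc r * suc r * 4)) * p ≡
                         (1 + (1 + 1 * (suc r * suc r) * 4) * (suc r * suc r) * 4) * p
    final-form = solve-∀
    open ≡-Reasoning
    value : 3 * 2 ^ i + (3 + r * 2) * g * d ≡ (1 + (1 + 1 * s * 4) * s * 4) * 2 ^ i
    value = begin
      3 * 2 ^ i + (3 + r * 2) * g * d                                          ≡⟨ cong (λ d → 3 * 2 ^ i + (3 + r * 2) * g * d) d≡ ⟩
      3 * 2 ^ i + (3 + r * 2) * g * (3 * ((1 + r * 2) * 2 ^ i))                ≡⟨ regroup (2 ^ i) r g ⟩
      (3 + (3 + r * 2) * (1 + r * 2) * (3 * g)) * 2 ^ i                        ≡⟨ cong (λ n → (3 + (3 + r * 2) * (1 + r * 2) * n) * 2 ^ i) g≡ ⟩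
      (3 + (3 + r * 2) * (1 + r * 2) * (2 + s * 4)) * 2 ^ i                    ≡⟨ cong (λ n → (3 + (3 + r * 2) * (1 + r * 2) * (2 + n * n * 4)) * 2 ^ i) r≡ ⟩
      (3 + (3 + r * 2) * (1 + r * 2) * (2 + suc r * suc r * 4)) * 2 ^ i        ≡⟨ final-form (2 ^ i) r ⟩
      (1 + (1 + 1 * (suc r * suc r) * 4) * (suc r * suc r) * 4) * 2 ^ i        ≡⟨ cong (λ n → (1 + (1 + 1 * (n * n) * 4) * (n * n) * 4) * 2 ^ i) r≡ ⟨
      (1 + (1 + 1 * s * 4) * s * 4) * 2 ^ i                                    ∎

-- Failure of regularity

block-confusion : ∀ {L} → Regular L → ∃₂ λ i j → i < j ×
  (∀ w → (L (block (2 ^ i) ++ w) → L (block (2 ^ j) ++ w)) × (L (block (2 ^ j) ++ w) → L (block (2 ^ i) ++ w)))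
block-confusion {L} (M , L⊆M , M⊆L)
  -- Among one more block than there are states, two lead to the same state and so admit the same
  -- continuations.
  with Fin.pigeonhole (n<1+n _) (λ i → foldl (DFA.δ M) (DFA.start M) (block (2 ^ toℕ i)))
... | i , j , i<j , eq = toℕ i , toℕ j , i<j , λ w → transfer w eq , transfer w (sym eq)
  where
  open DFA M renaming (δ to δᴹ; start to startᴹ; final to finalᴹ)
  transfer : ∀ {u v} w → foldl δᴹ startᴹ u ≡ foldl δᴹ startᴹ v → L (u ++ w) → L (v ++ w)
  transfer {u} {v} w eq Lu = M⊆L (subst (_∈ˢ finalᴹ) same (L⊆M Lu))
    where
    same : foldl δᴹ startᴹ (u ++ w) ≡ foldl δᴹ startᴹ (v ++ w)
    same = trans (foldl-++ δᴹ startᴹ u w) (trans (cong (λ q → foldl δᴹ q w) eq) (sym (foldl-++ δᴹ startᴹ v w)))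

-- This is `line (2 ^ i)` with its first heap replaced by `2 ^ j`; the word after the first block
-- depends on `i` only, as the confusion of two prefixes requires.
powers : ℕ → ℕ → Vec ℕ 3
powers i j = 2 ^ j ∷ 2 ^ i * 2 ∷ 2 ^ i * 3 ∷ []

equal-powers-P : ∀ i → P-words (word (powers i i))
equal-powers-P i = NimZero⇒P-word (NimZero-2^ i)

unequal-powers-N : ∀ {i j} → i < j → N-words (word (powers i j))
unequal-powers-N {i} {j} i<j = ¬NimZero⇒N-word λ z →
  >⇒≢ (^-monoʳ-< 2 (s≤s (s≤s z≤n)) i<j) (NimZero-unique 0F (NimZero-2^ i) z)

P-words-not-regular : ¬ Regular P-words
P-words-not-regular reg with block-confusion reg
... | i , j , i<j , same = unequal-powers-N i<j (proj₁ (same _) (equal-powers-P i))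

N-words-not-regular : ¬ Regular N-words
N-words-not-regular reg with block-confusion reg
... | i , j , i<j , same = proj₂ (same _) (unequal-powers-N i<j) (equal-powers-P i)

theorem3 : (¬ Regular P-words × ¬ Regular N-words) × (¬ ContextFree P-words × ¬ ContextFree N-words)
theorem3 = (P-words-not-regular , N-words-not-regular) , (P-words-not-CF , N-words-not-CF)
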